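{- Let $a$ and $n$ be even positive integers with $n \geq a(6a+2)$, and let $d \geq 2$ be an integer. Then the $(a,1)$ knight's graph on $[n]^d$ has a Hamiltonian cycle (an $(a,1)$ knight's tour).
   Context: $[n]=\{0,1,\dots,n-1\}$. For positive integers $a,b$, the $(a,b)$ knight's graph on $[n]^d$ has vertex set $[n]^d$, two vertices being adjacent iff they differ in exactly two coordinates, by $a$ in absolute value in one of them and by $b$ in absolute value in the other. An $(a,b)$ knight's tour is a Hamiltonian cycle in this graph. -}

module Defs where

open import Data.Nat using (ℕ; suc; _^_; _∸_; ∣_-_∣)
open import Data.Fin using (Fin; toℕ)
open import Data.Vec using (Vec; lookup)
open import Data.Product using (Σ; _×_)
open import Data.Sum using (_⊎_)
open import Relation.Binary.PropositionalEquality using (_≡_; _≢_)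
open import Function.Bundles using (Bijection)
open import Function.Base using (_on_)

-- Vertices of [n]^d : length-d vectors over [n] = {0,…,n-1}.
-- (Vectors are used so that vertex equality is structural, no funext needed.)
Vertex : ℕ → ℕ → Set
Vertex n d = Vec (Fin n) d

KnightAdj : (a b n d : ℕ) → Vertex n d → Vertex n d → Set
KnightAdj a b n d x y =
  Σ (Fin d) λ i → Σ (Fin d) λ j →
    (i ≢ j) ×
    (∣ toℕ (lookup x i) - toℕ (lookup y i) ∣ ≡ a) ×
    (∣ toℕ (lookup x j) - toℕ (lookup y j) ∣ ≡ b) ×
    ((k : Fin d) → k ≢ i → k ≢ j → lookup x k ≡ lookup y k)

CycSucc : (N : ℕ) → Fin N → Fin N → Set
CycSucc N i j = (toℕ j ≡ suc (toℕ i)) ⊎ ((toℕ i ≡ N ∸ 1) × (toℕ j ≡ 0))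

KnightTour : (a b n d : ℕ) → Set
KnightTour a b n d =
  Σ (Bijection (≡-setoid (Fin (n ^ d))) (≡-setoid (Vertex n d))) λ σ →
    (i j : Fin (n ^ d)) → CycSucc (n ^ d) i j →
      KnightAdj a b n d (Bijection.to σ i) (Bijection.to σ j)
  where open import Relation.Binary.PropositionalEquality using (setoid)
        ≡-setoid = setoid

{-# OPTIONS --safe #-}
module Submission where

-- Write a = 2h and n = 2m.  Two cycles containing edges u v and u′ v′ with u next to u′ and v next
-- to v′ merge into one, and all cycles are glued together in this way.
--
-- Fix ρ < h and put z = ρ + j h.  On the squares (X , 2z + δ) a move changes either X and j by 1, or
-- X by a and δ; so these squares fall into two classes, according to the parity of X + j.  A class
-- is cut into bands of consecutive levels j.  Two levels carry two cycles, on which δ is a function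
-- of X.  With three levels a colour count forces the cycle to wind: X increases by a in unit steps
-- and a jump by −a leads back to the start with δ changed, so the cycle closes up after two rounds.
-- This occupies a slab of 2a + 2 values of X, and the remaining values come in groups of 2a, that is,
-- m = v (2h + 1) + u · 2h.  The three-level bands also glue neighbouring classes to each other.
--
-- In dimension d + 1 the n layers are glued along pairs of edges displaced by a; two such pairs in the
-- d-dimensional tour are enough to provide two pairs in the next one.

open import Defs
open import Data.Nat using (ℕ; _*_; _+_; _≤_; _≥_)
open import Data.Nat.Divisibility using (_∣_)

open import Data.Bool using (Bool; true; false; not; _xor_)
open import Data.Empty using (⊥-elim)
open import Data.Fin using (Fin; zero; suc; toℕ; punchOut; combine; finToFun; funToFin) renaming (cast to castFin)
open import Data.Fin.Properties using (toℕ<n; toℕ-injective; toℕ-fromℕ<; toℕ-cast; funToFin-finToFin; punchOut-injective; any?; injective⇒≤; cast-is-id; cast-trans) renaming (_≟_ to _≟F_)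
open import Data.List using (List; []; _∷_; _++_; length; map; lookup)
open import Data.List.Properties using (length-++; ++-assoc; length-map; map-++)
open import Data.List.Membership.Propositional using (_∈_)
open import Data.List.Membership.Propositional.Properties using (∈-++⁺ˡ; ∈-++⁺ʳ; ∈-++⁻; ∈-map⁺; ∈-map⁻)
open import Data.List.Relation.Unary.All using (All; []; _∷_)
import Data.List.Relation.Unary.All as All
open import Data.List.Relation.Unary.Any using (here; there) renaming (index to any-index)
open import Data.List.Relation.Unary.Any.Properties using (lookup-index)
open import Data.Nat using (zero; suc; _∸_; _^_; _⊓_; ⌊_/2⌋; ∣_-_∣; _<_; _<?_; z≤n; s≤s; s≤s⁻¹)
open import Data.Nat.Divisibility using (divides)
open import Data.Nat.DivMod using (_/_; _%_; _mod_; m%n<n; m≡m%n+[m/n]*n; [m+kn]%n≡m%n; m<n⇒m%n≡m; m<n⇒m/n≡0; m/n≡1+[m∸n]/n; /-monoˡ-≤; m*n/n≡m)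
open import Data.Nat.Properties
open import Data.Nat.Tactic.RingSolver using (solve-∀)
open import Data.Product using (∃; ∃₂; _×_; _,_; proj₁; proj₂)
open import Data.Sum using (_⊎_; inj₁; inj₂; swap; [_,_]′)
open import Data.Unit using (⊤; tt)
open import Data.Vec using ([]; _∷_; head; tail; tabulate) renaming (lookup to lookupV)
open import Data.Vec.Properties using (lookup∘tabulate)
open import Function using (_∘_; id; case_of_)
open import Relation.Binary.Definitions using (Symmetric)
open import Relation.Binary.PropositionalEquality using (_≡_; _≢_; refl; sym; trans; cong; cong₂; subst; subst₂)
open import Relation.Nullary using (¬_; yes; no)

-- Moves alternate the parity of X + δ. If δ were a function c of x along a cycle on three levels,
-- the columns X = 2x, 2x + 1 would hold two cells of one colour and one of the other, so c would
-- have to take both values equally often, which is impossible for odd m. On two levels each x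
-- contributes one cell of either colour. This is why three levels need a slab with an odd number 2h
-- + 1 of values x, where both δ occur over each x, while 2h further values can be added as 6-cycles
-- over x and x + h with opposite δ, each balanced by itself. Two-level bands alone would not do:
-- heights may be odd, and the two cycles of such a band are joined only through the band beneath.
-- Gluing destroys edges, so each cycle carries a relation of edges guaranteed to lie on it, and the
-- constructions are arranged so that enough of them survive for all later gluings. Freedom from
-- repetitions is not carried along: a cycle records its length and the set it covers, and as the
-- final length is n^d, the pigeonhole principle excludes repetitions at the very end.

private variable
  V W : Set

-- Cycles in a graph

data Steps {V : Set} : V → List V → V → V → Set where
  first : ∀ {x y l} → Steps x (y ∷ l) x y
  later : ∀ {x y l p q} → Steps y l p q → Steps x (y ∷ l) p q

last : V → List V → V
last x []      = x
last x (y ∷ l) = last y l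

last-++ : ∀ (x : V) l y m → last x (l ++ y ∷ m) ≡ last y m
last-++ x []      y m = refl
last-++ x (z ∷ l) y m = last-++ z l y m

steps-weaken : ∀ {x : V} {l} m {p q} → Steps x l p q → Steps x (l ++ m) p q
steps-weaken m first     = first
steps-weaken m (later s) = later (steps-weaken m s)

steps-++ˡ : ∀ {x y : V} l m {p q} → Steps x (l ++ y ∷ []) p q → Steps x (l ++ y ∷ m) p q
steps-++ˡ []      m first     = first
steps-++ˡ []      m (later ())
steps-++ˡ (z ∷ l) m first     = first
steps-++ˡ (z ∷ l) m (later s) = later (steps-++ˡ l m s)

steps-++ʳ : ∀ {x y : V} l {m p q} → Steps y m p q → Steps x (l ++ y ∷ m) p q
steps-++ʳ []      s = later s
steps-++ʳ (z ∷ l) s = later (steps-++ʳ l s)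

steps-split : ∀ {x y : V} l {m p q} → Steps x (l ++ y ∷ m) p q →
  Steps x (l ++ y ∷ []) p q ⊎ Steps y m p q
steps-split []      first     = inj₁ first
steps-split []      (later s) = inj₂ s
steps-split (z ∷ l) first     = inj₁ first
steps-split (z ∷ l) (later s) = [ inj₁ ∘ later , inj₂ ]′ (steps-split l s)

steps-snoc : ∀ {x w : V} l {p q} → Steps x (l ++ w ∷ []) p q →
  Steps x l p q ⊎ (p ≡ last x l × q ≡ w)
steps-snoc []      first     = inj₂ (refl , refl)
steps-snoc []      (later ())
steps-snoc (z ∷ l) first     = inj₁ first
steps-snoc (z ∷ l) (later s) = [ inj₁ ∘ later , inj₂ ]′ (steps-snoc l s)

steps-last : ∀ {x : V} l {w m} → Steps x (l ++ w ∷ m) (last x l) w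
steps-last []      = first
steps-last (z ∷ l) = later (steps-last l)

steps-∈ : ∀ {x : V} {l p q} → Steps x l p q → p ∈ x ∷ l × q ∈ x ∷ l
steps-∈ first     = here refl , there (here refl)
steps-∈ (later s) with steps-∈ s
... | i , j = there i , there j

steps-map : ∀ (f : V → W) {x l p q} → Steps x l p q → Steps (f x) (map f l) (f p) (f q)
steps-map f first     = first
steps-map f (later s) = later (steps-map f s)

steps-unmap : ∀ (f : V → W) {x} l {p q} → Steps (f x) (map f l) p q →
  ∃₂ λ u v → Steps x l u v × p ≡ f u × q ≡ f v
steps-unmap f (y ∷ l) first     = _ , _ , first , refl , refl
steps-unmap f (y ∷ l) (later s) with steps-unmap f l s
... | u , v , t , e , e′ = u , v , later t , e , e′

-- Repeating the head at the end turns the closing edge into an ordinary step.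
Loop : V → List V → V → V → Set
Loop x xs = Steps x (xs ++ x ∷ [])

loop-∈ : ∀ {x : V} {xs p q} → Loop x xs p q → p ∈ x ∷ xs × q ∈ x ∷ xs
loop-∈ {x = x} {xs} s with steps-∈ s
... | i , j = back i , back j
  where
  back : ∀ {z} → z ∈ x ∷ (xs ++ x ∷ []) → z ∈ x ∷ xs
  back (here e)  = here e
  back (there k) with ∈-++⁻ xs k
  ... | inj₁ k′          = there k′
  ... | inj₂ (here refl) = here refl

locate : ∀ {x z : V} xs {u v} → Steps x (xs ++ z ∷ []) u v →
  (v ≡ z × last x xs ≡ u) ⊎ (∃₂ λ A B → xs ≡ A ++ v ∷ B × last x A ≡ u)
locate []       first     = inj₁ (refl , refl)
locate []       (later ())
locate (y ∷ xs) first     = inj₂ ([] , xs , refl , refl)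
locate (y ∷ xs) (later s) with locate xs s
... | inj₁ e                  = inj₁ e
... | inj₂ (A , B , refl , e) = inj₂ (y ∷ A , B , refl , e)

-- The same cycle with `u v` as its closing edge, so that omitting this edge leaves a path from `v`
-- to `u`.
record Rotation {V : Set} (x : V) (xs : List V) (u v : V) : Set where
  field
    rest    : List V
    ends    : last v rest ≡ u
    size    : length rest ≡ length xs
    to-∈    : ∀ {w} → w ∈ x ∷ xs → w ∈ v ∷ rest
    from-∈  : ∀ {w} → w ∈ v ∷ rest → w ∈ x ∷ xs
    to-loop : ∀ {p q} → Loop x xs p q → Loop v rest p q
    from-loop : ∀ {p q} → Loop v rest p q → Loop x xs p q

rotate : ∀ {x : V} xs {u v} → Loop x xs u v → Rotation x xs u v
rotate xs s with locate xs s
... | inj₁ (refl , e) = record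
  { rest = xs ; ends = e ; size = refl ; to-∈ = id ; from-∈ = id ; to-loop = id ; from-loop = id }
rotate {x = x} .(A ++ v ∷ B) {u} {v} s | inj₂ (A , B , refl , e) = record
  { rest = B ++ x ∷ A
  ; ends = trans (last-++ v B x A) e
  ; size = trans (length-++ B) (trans (+-suc (length B) (length A))
             (trans (cong suc (+-comm (length B) (length A)))
             (trans (sym (+-suc (length A) (length B))) (sym (length-++ A)))))
  ; to-∈ = to ; from-∈ = from ; to-loop = tol ; from-loop = froml }
  where
  to : ∀ {w} → w ∈ x ∷ (A ++ v ∷ B) → w ∈ v ∷ (B ++ x ∷ A)
  to (here e)  = there (∈-++⁺ʳ B (here e))
  to (there i) with ∈-++⁻ A i
  ... | inj₁ j         = there (∈-++⁺ʳ B (there j))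
  ... | inj₂ (here e)  = here e
  ... | inj₂ (there j) = there (∈-++⁺ˡ j)
  from : ∀ {w} → w ∈ v ∷ (B ++ x ∷ A) → w ∈ x ∷ (A ++ v ∷ B)
  from (here e)  = there (∈-++⁺ʳ A (here e))
  from (there i) with ∈-++⁻ B i
  ... | inj₁ j         = there (∈-++⁺ʳ A (there j))
  ... | inj₂ (here e)  = here e
  ... | inj₂ (there j) = there (∈-++⁺ˡ j)
  -- Undoing a rotation is a rotation with `A` and `B` exchanged, so one function serves both
  -- directions.
  turn : ∀ {x v : V} A B {p q} → Steps x ((A ++ v ∷ B) ++ x ∷ []) p q → Steps v ((B ++ x ∷ A) ++ v ∷ []) p q
  turn {x = x} {v} A B {p} {q} t
    rewrite ++-assoc A (v ∷ B) (x ∷ []) | ++-assoc B (x ∷ A) (v ∷ []) with steps-split A t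
  ... | inj₁ t′ = steps-++ʳ B t′
  ... | inj₂ t′ = steps-++ˡ B (A ++ v ∷ []) t′
  tol : ∀ {p q} → Loop x (A ++ v ∷ B) p q → Loop v (B ++ x ∷ A) p q
  tol = turn A B
  froml : ∀ {p q} → Loop v (B ++ x ∷ A) p q → Loop x (A ++ v ∷ B) p q
  froml = turn B A

Same : V → V → V → V → Set
Same x y u v = (x ≡ u × y ≡ v) ⊎ (x ≡ v × y ≡ u)

apart : ∀ {x y u v : V} → x ≢ u → x ≢ v → ¬ Same x y u v
apart n _ (inj₁ (e , _)) = n e
apart _ n (inj₂ (e , _)) = n e

record Path {V : Set} (Adj : V → V → Set) (P : V → Set) (N : ℕ) (R : V → V → Set) (s e : V) : Set where
  field
    rest     : List V
    ends     : last s rest ≡ e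
    adjacent : ∀ {p q} → Steps s rest p q → Adj p q
    size     : suc (length rest) ≡ N
    sound    : ∀ {v} → v ∈ s ∷ rest → P v
    complete : ∀ {v} → P v → v ∈ s ∷ rest
    edge     : ∀ {p q} → R p q → Steps s rest p q ⊎ Steps s rest q p

-- `R` holds undirected edges guaranteed to be present, the places where the cycle may later be cut;
-- it need not contain all edges.
record Cycle {V : Set} (Adj : V → V → Set) (P : V → Set) (N : ℕ) (R : V → V → Set) : Set where
  field
    start    : V
    rest     : List V
    adjacent : ∀ {p q} → Loop start rest p q → Adj p q
    size     : suc (length rest) ≡ N
    sound    : ∀ {v} → v ∈ start ∷ rest → P v
    complete : ∀ {v} → P v → v ∈ start ∷ rest
    edge     : ∀ {p q} → R p q → Loop start rest p q ⊎ Loop start rest q p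

_∖_,_ : (V → V → Set) → V → V → V → V → Set
(R ∖ u , v) p q = R p q × ¬ Same p q u v

sumTo : (ℕ → ℕ) → ℕ → ℕ
sumTo N zero    = N zero
sumTo N (suc k) = sumTo N k + N (suc k)

-- Cutting cycles open and gluing them

module _ {Adj : V → V → Set} where

  weaken : ∀ {P P′ N N′} {R R′ : V → V → Set} → Cycle Adj P N R →
    (∀ {v} → P v → P′ v) → (∀ {v} → P′ v → P v) → N ≡ N′ → (∀ {p q} → R′ p q → R p q) → Cycle Adj P′ N′ R′
  weaken C f g e r = record
    { start = start ; rest = rest ; adjacent = adjacent ; size = trans size e
    ; sound = f ∘ sound ; complete = complete ∘ g ; edge = edge ∘ r }
    where open Cycle C

  edge-∈ : ∀ {P N R} (C : Cycle Adj P N R) {p q} → R p q → P p × P q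
  edge-∈ C r with Cycle.edge C r
  ... | inj₁ s with loop-∈ s
  ...   | i , j = Cycle.sound C i , Cycle.sound C j
  edge-∈ C r | inj₂ s with loop-∈ s
  ...   | i , j = Cycle.sound C j , Cycle.sound C i

  record Reversed (s : V) (l : List V) : Set where
    field
      rest   : List V
      ends   : last (last s l) rest ≡ s
      size   : length rest ≡ length l
      to-∈   : ∀ {w} → w ∈ s ∷ l → w ∈ last s l ∷ rest
      from-∈ : ∀ {w} → w ∈ last s l ∷ rest → w ∈ s ∷ l
      to     : ∀ {p q} → Steps s l p q → Steps (last s l) rest q p
      from   : ∀ {p q} → Steps (last s l) rest p q → Steps s l q p

  rev : ∀ s l → Reversed s l
  rev s []      = record
    { rest = [] ; ends = refl ; size = refl ; to-∈ = id ; from-∈ = id ; to = λ () ; from = λ () }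
  rev s (y ∷ l) with rev y l
  ... | r = record
    { rest = R.rest ++ s ∷ []
    ; ends = last-++ (last y l) R.rest s []
    ; size = trans (length-++ R.rest) (trans (+-comm (length R.rest) 1) (cong suc R.size))
    ; to-∈ = to-∈ ; from-∈ = from-∈ ; to = to ; from = from }
    where
    module R = Reversed r
    to-∈ : ∀ {w} → w ∈ s ∷ y ∷ l → w ∈ last y l ∷ (R.rest ++ s ∷ [])
    to-∈ (here e)  = ∈-++⁺ʳ (last y l ∷ R.rest) (here e)
    to-∈ (there i) = ∈-++⁺ˡ (R.to-∈ i)
    from-∈ : ∀ {w} → w ∈ last y l ∷ (R.rest ++ s ∷ []) → w ∈ s ∷ y ∷ l
    from-∈ i with ∈-++⁻ (last y l ∷ R.rest) i
    ... | inj₁ j        = there (R.from-∈ j)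
    ... | inj₂ (here e) = here e
    to : ∀ {p q} → Steps s (y ∷ l) p q → Steps (last y l) (R.rest ++ s ∷ []) q p
    to first     = subst (λ z → Steps (last y l) (R.rest ++ s ∷ []) z s) R.ends (steps-last R.rest)
    to (later t) = steps-weaken _ (R.to t)
    from : ∀ {p q} → Steps (last y l) (R.rest ++ s ∷ []) p q → Steps s (y ∷ l) q p
    from t with steps-snoc R.rest t
    ... | inj₁ t′            = later (R.from t′)
    ... | inj₂ (refl , refl) = subst (λ z → Steps s (y ∷ l) s z) (sym R.ends) first

  module _ (symm : Symmetric Adj) where

    reverse : ∀ {P N R s e} → Path Adj P N R s e → Path Adj P N R e s
    reverse {P} {N} {R} {s} record { rest = l ; ends = refl ; adjacent = adj ; size = sz ; sound = so ; complete = co ; edge = ed } = record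
      { rest = R.rest ; ends = R.ends ; adjacent = symm ∘ adj ∘ R.from ; size = trans (cong suc R.size) sz
      ; sound = so ∘ R.from-∈ ; complete = R.to-∈ ∘ co
      ; edge = λ r → [ inj₂ ∘ R.to , inj₁ ∘ R.to ]′ (ed r) }
      where module R = Reversed (rev s l)

    openLoop : ∀ {P N R} (C : Cycle Adj P N R) {u v} → Loop (Cycle.start C) (Cycle.rest C) u v →
      Path Adj P N (R ∖ u , v) v u
    openLoop C {u} {v} s = record
      { rest = R.rest ; ends = R.ends
      ; adjacent = C.adjacent ∘ R.from-loop ∘ steps-weaken _
      ; size = trans (cong suc R.size) C.size
      ; sound = C.sound ∘ R.from-∈ ; complete = R.to-∈ ∘ C.complete
      ; edge = λ { (r , n) → [ (λ t → inj₁ (keep n t)) , (λ t → inj₂ (keep (n ∘ swap′) t)) ]′ (C.edge r) } }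
      where
      module C = Cycle C
      module R = Rotation (rotate C.rest s)
      swap′ : ∀ {p q} → Same p q u v → Same q p u v
      swap′ (inj₁ (e , e′)) = inj₂ (e′ , e)
      swap′ (inj₂ (e , e′)) = inj₁ (e′ , e)
      keep : ∀ {p q} → ¬ Same p q u v → Loop C.start C.rest p q → Steps v R.rest p q
      keep n t with steps-snoc R.rest (R.to-loop t)
      ... | inj₁ t′       = t′
      ... | inj₂ (e , e′) = ⊥-elim (n (inj₁ (trans e R.ends , e′)))

    cut : ∀ {P N R} → Cycle Adj P N R → ∀ {u v} → R u v → Path Adj P N (R ∖ u , v) v u
    cut C r with Cycle.edge C r
    ... | inj₁ s = openLoop C s
    ... | inj₂ s = path (reverse (openLoop C s))
      where
      path : ∀ {P N R u v s e} → Path Adj P N (R ∖ u , v) s e → Path Adj P N (R ∖ v , u) s e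
      path p = record
        { rest = Path.rest p ; ends = Path.ends p ; adjacent = Path.adjacent p ; size = Path.size p
        ; sound = Path.sound p ; complete = Path.complete p
        ; edge = λ { (r , n) → Path.edge p (r , n ∘ swap) } }

    join : ∀ {P₁ P₂ N₁ N₂ R₁ R₂ s₁ e₁ s₂ e₂} → Path Adj P₁ N₁ R₁ s₁ e₁ → Path Adj P₂ N₂ R₂ s₂ e₂ →
      Adj e₁ s₂ → Adj e₂ s₁ →
      Cycle Adj (λ v → P₁ v ⊎ P₂ v) (N₁ + N₂)
        (λ p q → (R₁ p q ⊎ R₂ p q) ⊎ ((p ≡ e₁ × q ≡ s₂) ⊎ (p ≡ s₁ × q ≡ e₂)))
    join {P₁} {P₂} {R₁ = R₁} {R₂} {s₁} {e₁} {s₂} {e₂} p₁ p₂ a b = record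
      { start = s₁ ; rest = l₁ ++ s₂ ∷ l₂
      ; adjacent = adj
      ; size = trans (cong suc (length-++ l₁)) (cong₂ _+_ (Path.size p₁) (Path.size p₂))
      ; sound = so ; complete = co ; edge = ed }
      where
      l₁ = Path.rest p₁
      l₂ = Path.rest p₂
      assoc : (l₁ ++ s₂ ∷ l₂) ++ s₁ ∷ [] ≡ l₁ ++ s₂ ∷ (l₂ ++ s₁ ∷ [])
      assoc = ++-assoc l₁ (s₂ ∷ l₂) (s₁ ∷ [])
      into : ∀ {p q} → Steps s₁ (l₁ ++ s₂ ∷ (l₂ ++ s₁ ∷ [])) p q → Loop s₁ (l₁ ++ s₂ ∷ l₂) p q
      into {p} {q} = subst (λ l → Steps s₁ l p q) (sym assoc)
      adj : ∀ {p q} → Loop s₁ (l₁ ++ s₂ ∷ l₂) p q → Adj p q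
      adj {p} {q} t with steps-split l₁ (subst (λ l → Steps s₁ l p q) assoc t)
      adj t | inj₁ t′ with steps-snoc l₁ t′
      ... | inj₁ t″ = Path.adjacent p₁ t″
      ... | inj₂ (refl , refl) = subst (λ z → Adj z s₂) (sym (Path.ends p₁)) a
      adj t | inj₂ t′ with steps-snoc l₂ t′
      ... | inj₁ t″ = Path.adjacent p₂ t″
      ... | inj₂ (refl , refl) = subst (λ z → Adj z s₁) (sym (Path.ends p₂)) b
      so : ∀ {v} → v ∈ s₁ ∷ (l₁ ++ s₂ ∷ l₂) → P₁ v ⊎ P₂ v
      so i with ∈-++⁻ (s₁ ∷ l₁) i
      ... | inj₁ j = inj₁ (Path.sound p₁ j)
      ... | inj₂ j = inj₂ (Path.sound p₂ j)
      co : ∀ {v} → P₁ v ⊎ P₂ v → v ∈ s₁ ∷ (l₁ ++ s₂ ∷ l₂)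
      co (inj₁ p) = ∈-++⁺ˡ (Path.complete p₁ p)
      co (inj₂ p) = ∈-++⁺ʳ (s₁ ∷ l₁) (Path.complete p₂ p)
      lft : ∀ {p q} → Steps s₁ l₁ p q → Loop s₁ (l₁ ++ s₂ ∷ l₂) p q
      lft t = into (steps-weaken _ t)
      rgt : ∀ {p q} → Steps s₂ (l₂ ++ s₁ ∷ []) p q → Loop s₁ (l₁ ++ s₂ ∷ l₂) p q
      rgt t = into (steps-++ʳ l₁ t)
      E : V → V → Set
      E p q = Loop s₁ (l₁ ++ s₂ ∷ l₂) p q ⊎ Loop s₁ (l₁ ++ s₂ ∷ l₂) q p
      ed : ∀ {p q} → (R₁ p q ⊎ R₂ p q) ⊎ ((p ≡ e₁ × q ≡ s₂) ⊎ (p ≡ s₁ × q ≡ e₂)) → E p q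
      ed (inj₁ (inj₁ r)) = [ inj₁ ∘ lft , inj₂ ∘ lft ]′ (Path.edge p₁ r)
      ed (inj₁ (inj₂ r)) = [ inj₁ ∘ rgt ∘ steps-weaken _ , inj₂ ∘ rgt ∘ steps-weaken _ ]′ (Path.edge p₂ r)
      ed (inj₂ (inj₁ (refl , refl))) =
        inj₁ (into (subst (λ z → Steps s₁ (l₁ ++ s₂ ∷ (l₂ ++ s₁ ∷ [])) z s₂) (Path.ends p₁) (steps-last l₁)))
      ed (inj₂ (inj₂ (refl , refl))) =
        inj₂ (rgt (subst (λ z → Steps s₂ (l₂ ++ s₁ ∷ []) z s₁) (Path.ends p₂) (steps-last l₂)))

    -- Cutting the two edges leaves two paths; the second is reversed so that their ends match. The
    -- two new connecting edges are not recorded.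
    merge : ∀ {P₁ P₂ N₁ N₂ R₁ R₂} → Cycle Adj P₁ N₁ R₁ → Cycle Adj P₂ N₂ R₂ →
      ∀ {u v u′ v′} → R₁ u v → R₂ u′ v′ → Adj u u′ → Adj v v′ →
      Cycle Adj (λ v → P₁ v ⊎ P₂ v) (N₁ + N₂) (λ p q → (R₁ ∖ u , v) p q ⊎ (R₂ ∖ u′ , v′) p q)
    merge C₁ C₂ r₁ r₂ a b =
      weaken (join (cut C₁ r₁) (reverse (cut C₂ r₂)) a (symm b)) id id refl inj₁

    -- The edge `u v` is replaced by a detour through two new vertices. Unlike in `merge`, the
    -- connecting edges are recorded, since two-level bands are attached along them.
    insert : ∀ {P N R} → Cycle Adj P N R → ∀ {u v u′ v′} → R u v → Adj u u′ → Adj u′ v′ → Adj v v′ →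
      Cycle Adj (λ w → P w ⊎ (w ≡ u′ ⊎ w ≡ v′)) (N + 2)
        (λ p q → (R ∖ u , v) p q ⊎ ((p ≡ u′ × q ≡ v′) ⊎ ((p ≡ u × q ≡ u′) ⊎ (p ≡ v × q ≡ v′))))
    insert C {u} {v} {u′} {v′} r a b c =
      weaken (join (cut C r) domino a (symm c)) id id refl
        [ inj₁ ∘ inj₁ , [ inj₁ ∘ inj₂ , inj₂ ]′ ]′
      where
      domino : Path Adj (λ w → w ≡ u′ ⊎ w ≡ v′) 2 (λ p q → p ≡ u′ × q ≡ v′) u′ v′
      domino = record
        { rest = v′ ∷ [] ; ends = refl
        ; adjacent = λ { first → b ; (later ()) }
        ; size = refl
        ; sound = λ { (here e) → inj₁ e ; (there (here e)) → inj₂ e }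
        ; complete = λ { (inj₁ e) → here e ; (inj₂ e) → there (here e) }
        ; edge = λ { (refl , refl) → inj₁ first } }

    -- `F` consists of the edges that no gluing touches. Besides these the invariant `Rk` has to
    -- keep available just the outgoing edge of the latest cycle.
    chain : ∀ {P : ℕ → V → Set} {N : ℕ → ℕ} {R F : ℕ → V → V → Set} {u v u′ v′ : ℕ → V} (K : ℕ) →
      (∀ {i j w} → P i w → P j w → i ≡ j) →
      (∀ {i} → i ≤ K → Cycle Adj (P i) (N i) (R i)) →
      (∀ {i} → R i (u i) (v i)) → (∀ {i} → R (suc i) (u′ (suc i)) (v′ (suc i))) →
      (∀ {i} → ¬ Same (u i) (v i) (u′ i) (v′ i)) →
      (∀ {i} → i < K → Adj (u i) (u′ (suc i))) → (∀ {i} → i < K → Adj (v i) (v′ (suc i))) →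
      (∀ {i p q} → F i p q → R i p q) →
      (∀ {i p q} → F i p q → ¬ Same p q (u i) (v i)) →
      (∀ {i p q} → F (suc i) p q → ¬ Same p q (u′ (suc i)) (v′ (suc i))) →
      Cycle Adj (λ w → ∃ λ i → i ≤ K × P i w) (sumTo N K) (λ p q → ∃ λ i → i ≤ K × F i p q)
    chain {P} {N} {R} {F} {u} {v} {u′} {v′} K disj cyc out inn oi a b sub fo fi =
      weaken (go K ≤-refl) id id refl inj₁
      where
      Rk : ℕ → V → V → Set
      Rk k p q = (∃ λ i → i ≤ k × F i p q) ⊎ (p ≡ u k × q ≡ v k)
      go : ∀ k → k ≤ K → Cycle Adj (λ w → ∃ λ i → i ≤ k × P i w) (sumTo N k) (Rk k)
      go zero k≤K = weaken (cyc k≤K) (λ p → zero , z≤n , p) (λ { (zero , z≤n , p) → p }) refl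
        λ { (inj₁ (zero , z≤n , f)) → sub f ; (inj₂ (refl , refl)) → out }
      go (suc k) k<K = weaken
        (merge (go k (<⇒≤ k<K)) (cyc k<K) (inj₂ (refl , refl)) (inn {k}) (a k<K) (b k<K))
        (λ { (inj₁ (i , i≤k , p)) → i , m≤n⇒m≤1+n i≤k , p ; (inj₂ p) → suc k , ≤-refl , p })
        (λ { (i , i≤1+k , p) → case m≤n⇒m<n∨m≡n i≤1+k of λ
           { (inj₁ i<1+k) → inj₁ (i , s≤s⁻¹ i<1+k , p) ; (inj₂ refl) → inj₂ p } })
        refl
        λ { (inj₂ (refl , refl)) → inj₂ (out , oi)
          ; (inj₁ (i , i≤1+k , f)) → case m≤n⇒m<n∨m≡n i≤1+k of λ
             { (inj₁ i<1+k) → inj₁ (inj₁ (i , s≤s⁻¹ i<1+k , f) , old k<K (s≤s⁻¹ i<1+k) f)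
             ; (inj₂ refl)  → inj₂ (sub f , fi f) } }
        where
        -- An untouched edge of an earlier cycle is not the edge being cut, for otherwise a vertex
        -- would lie on two different cycles.
        old : ∀ {i p q} → k < K → i ≤ k → F i p q → ¬ Same p q (u k) (v k)
        old k<K i≤k f s with m≤n⇒m<n∨m≡n i≤k
        ... | inj₂ refl = fo f s
        old {i} k<K i≤k f s | inj₁ i<k = <⇒≢ i<k (disj (hit s) (proj₁ fo′))
          where
          fo′ = edge-∈ (cyc (<⇒≤ k<K)) (out {k})
          fp = edge-∈ (cyc (≤-trans i≤k (<⇒≤ k<K))) (sub f)
          hit : Same _ _ (u k) (v k) → P i (u k)
          hit (inj₁ (refl , _)) = proj₁ fp
          hit (inj₂ (_ , refl)) = proj₂ fp

    -- All satellites hang on one central cycle, each at an edge of its own; `Rk` keeps the central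
    -- edges still waiting for their satellite.
    star : ∀ {P₀ : V → Set} {N₀} {R₀ F₀ : V → V → Set} {P : ℕ → V → Set} {M} {R F : ℕ → V → V → Set} {u v u′ v′ : ℕ → V} (K : ℕ) →
      Cycle Adj P₀ N₀ R₀ → (∀ {j} → j < K → Cycle Adj (P j) M (R j)) →
      (∀ {j} → j < K → R₀ (u j) (v j)) → (∀ {j} → R j (u′ j) (v′ j)) →
      (∀ {j} → Adj (u j) (u′ j)) → (∀ {j} → Adj (v j) (v′ j)) →
      (∀ {i j} → i ≢ j → ¬ Same (u i) (v i) (u j) (v j)) →
      (∀ {p q} → F₀ p q → R₀ p q) → (∀ {j p q} → j < K → F₀ p q → ¬ Same p q (u j) (v j)) →
      (∀ {j p q} → F j p q → R j p q) → (∀ {j p q} → F j p q → ¬ Same p q (u′ j) (v′ j)) →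
      (∀ {i j p q} → i < K → j < K → F i p q → ¬ Same p q (u j) (v j)) →
      Cycle Adj (λ w → P₀ w ⊎ ∃ λ j → j < K × P j w) (N₀ + K * M) (λ p q → F₀ p q ⊎ ∃ λ j → j < K × F j p q)
    star {P₀} {N₀} {R₀} {F₀} {P} {M} {R} {F} {u} {v} {u′} {v′} K C₀ cyc out inn a b uu sub₀ f₀ sub fi fo =
      weaken (go K ≤-refl) id id refl [ inj₁ , inj₂ ∘ inj₂ ]′
      where
      Rk : ℕ → V → V → Set
      Rk k p q = F₀ p q ⊎ ((∃ λ j → k ≤ j × j < K × p ≡ u j × q ≡ v j) ⊎ (∃ λ j → j < k × F j p q))
      go : ∀ k → k ≤ K → Cycle Adj (λ w → P₀ w ⊎ ∃ λ j → j < k × P j w) (N₀ + k * M) (Rk k)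
      go zero _ = weaken C₀ inj₁ (λ { (inj₁ p) → p ; (inj₂ (_ , () , _)) }) (+-comm 0 N₀)
        λ { (inj₁ f) → sub₀ f ; (inj₂ (inj₁ (j , _ , j<K , refl , refl))) → out j<K ; (inj₂ (inj₂ (_ , () , _))) }
      go (suc k) k<K = weaken
        (merge (go k (<⇒≤ k<K)) (cyc k<K) (inj₂ (inj₁ (k , ≤-refl , k<K , refl , refl))) inn a b)
        (λ { (inj₁ (inj₁ p)) → inj₁ p ; (inj₁ (inj₂ (j , j<k , p))) → inj₂ (j , m≤n⇒m≤1+n j<k , p)
           ; (inj₂ p) → inj₂ (k , ≤-refl , p) })
        (λ { (inj₁ p) → inj₁ (inj₁ p)
           ; (inj₂ (j , j<1+k , p)) → case m≤n⇒m<n∨m≡n (s≤s⁻¹ j<1+k) of λ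
              { (inj₁ j<k) → inj₁ (inj₂ (j , j<k , p)) ; (inj₂ refl) → inj₂ p } })
        (trans (+-assoc N₀ (k * M) M) (cong (N₀ +_) (+-comm (k * M) M)))
        λ { (inj₁ f) → inj₁ (inj₁ f , f₀ k<K f)
          ; (inj₂ (inj₁ (j , k<j , j<K , refl , refl))) →
              inj₁ (inj₂ (inj₁ (j , <⇒≤ k<j , j<K , refl , refl)) , uu (λ e → <⇒≢ k<j (sym e)))
          ; (inj₂ (inj₂ (j , j<1+k , f))) → case m≤n⇒m<n∨m≡n (s≤s⁻¹ j<1+k) of λ
              { (inj₁ j<k) → inj₁ (inj₂ (inj₂ (j , j<k , f)) , fo (<-trans j<k k<K) k<K f)
              ; (inj₂ refl) → inj₂ (sub f , fi f) } }

mapCycle : ∀ {Adj : V → V → Set} {Adj′ : W → W → Set} {P N R} (f : V → W) → Cycle Adj P N R →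
  (∀ {p q} → P p → P q → Adj p q → Adj′ (f p) (f q)) →
  Cycle Adj′ (λ w → ∃ λ v → P v × w ≡ f v) N (λ p q → ∃₂ λ u v → R u v × p ≡ f u × q ≡ f v)
mapCycle {Adj′ = Adj′} {P} {R = R} f C g = record
  { start = f start ; rest = map f rest
  ; adjacent = adj
  ; size = trans (cong suc (length-map f rest)) size
  ; sound = λ i → case ∈-map⁻ f {xs = start ∷ rest} i of λ { (v , j , e) → v , sound j , e }
  ; complete = λ { (v , p , refl) → ∈-map⁺ f {xs = start ∷ rest} (complete p) }
  ; edge = λ { (u , v , r , refl , refl) → [ inj₁ ∘ up , inj₂ ∘ up ]′ (edge r) } }
  where
  open Cycle C
  eq : map f (rest ++ start ∷ []) ≡ map f rest ++ f start ∷ []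
  eq = map-++ f rest (start ∷ [])
  up : ∀ {p q} → Loop start rest p q → Loop (f start) (map f rest) (f p) (f q)
  up {p} {q} t = subst (λ l → Steps (f start) l (f p) (f q)) eq (steps-map f t)
  adj : ∀ {p q} → Loop (f start) (map f rest) p q → Adj′ p q
  adj {p} {q} t with steps-unmap f (rest ++ start ∷ []) (subst (λ l → Steps (f start) l p q) (sym eq) t)
  ... | u , v , s , refl , refl = case loop-∈ s of λ { (i , j) → g (sound i) (sound j) (adjacent s) }

Walk : (V → V → Set) → V → List V → Set
Walk Adj x []      = ⊤
Walk Adj x (y ∷ l) = Adj x y × Walk Adj y l

walk-steps : ∀ {Adj : V → V → Set} {x l p q} → Walk Adj x l → Steps x l p q → Adj p q
walk-steps (a , _) first     = a
walk-steps (_ , w) (later s) = walk-steps w s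

-- Three levels

data Flip : Bool → Bool → Set where
  ft : Flip false true
  tf : Flip true false

flip-sym : ∀ {δ δ′} → Flip δ δ′ → Flip δ′ δ
flip-sym ft = tf
flip-sym tf = ft

flip-det : ∀ {δ ε ε′} → Flip δ ε → Flip δ ε′ → ε ≡ ε′
flip-det ft ft = refl
flip-det tf tf = refl

flip-≢ : ∀ {δ ε} → Flip δ ε → δ ≢ ε
flip-≢ ft ()
flip-≢ tf ()

flip-not : ∀ δ → Flip δ (not δ)
flip-not false = ft
flip-not true  = tf

-- With X the first coordinate, j the level and δ the parity bit of the row (see Cell below),
-- a₀ x δ, a₂ x δ and b x δ stand for (X , j) = (2x , 0), (2x , 2) and (2x + 1 , 1).
data Tri : Set where
  a₀ a₂ b : ℕ → Bool → Tri

index : Tri → ℕ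
index (a₀ x _) = x
index (a₂ x _) = x
index (b x _)  = x

module _ (g : ℕ) where

  private
    h : ℕ
    h = suc g

  data TriEdge : Tri → Tri → Set where
    ab₀ : ∀ {x δ} → TriEdge (a₀ x δ) (b x δ)
    ab₂ : ∀ {x δ} → TriEdge (a₂ x δ) (b x δ)
    ba₀ : ∀ {x δ} → TriEdge (b x δ) (a₀ (suc x) δ)
    ba₂ : ∀ {x δ} → TriEdge (b x δ) (a₂ (suc x) δ)
    jump₀ : ∀ {x y δ δ′} → y ≡ x + h → Flip δ δ′ → TriEdge (a₀ x δ) (a₀ y δ′)
    jump₂ : ∀ {x y δ δ′} → y ≡ x + h → Flip δ δ′ → TriEdge (a₂ x δ) (a₂ y δ′)
    jump  : ∀ {x y δ δ′} → y ≡ x + h → Flip δ δ′ → TriEdge (b x δ) (b y δ′)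

  TriAdj : Tri → Tri → Set
  TriAdj p q = TriEdge p q ⊎ TriEdge q p

  -- The last vertex is adjacent both to the first one and to `a₀ (suc c + h) δ`. The same six
  -- vertices thus serve as a closed 6-cycle and as one period of the winding slab.
  hex : ℕ → Bool → Bool → List Tri → List Tri
  hex c δ δ′ r = a₀ (c + h) δ ∷ a₀ c δ′ ∷ b c δ′ ∷ a₂ c δ′ ∷ a₂ (c + h) δ ∷ b (c + h) δ ∷ r

  -- At the final position `a₀` is left out: it belongs to the continuation, as the place from which
  -- the walk jumps back by h.
  hexes : ℕ → ℕ → Bool → Bool → List Tri → List Tri
  hexes c zero    δ δ′ r = a₂ (c + h) δ ∷ b (c + h) δ ∷ r
  hexes c (suc k) δ δ′ r = hex c δ δ′ (hexes (suc c) k δ δ′ r)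

  hexes-++ : ∀ c k {δ δ′} r s → hexes c k δ δ′ r ++ s ≡ hexes c k δ δ′ (r ++ s)
  hexes-++ c zero    r s = refl
  hexes-++ c (suc k) {δ} {δ′} r s = cong (hex c δ δ′) (hexes-++ (suc c) k r s)

  hexes-length : ∀ c k {δ δ′} r → length (hexes c k δ δ′ r) ≡ k * 6 + (2 + length r)
  hexes-length c zero    r = refl
  hexes-length c (suc k) r = cong (6 +_) (hexes-length (suc c) k r)

  -- The entry is at `a₀` if a hexagon follows and at `a₂` if none is left, whence two hypotheses on
  -- `s`. Between hexagons `s` is a `b`, adjacent to both.
  hexes-walk : ∀ {s e} c k {δ δ′ r} → Flip δ δ′ → e ≡ c + k →
    TriAdj s (a₀ (c + h) δ) → (k ≡ 0 → TriAdj s (a₂ (c + h) δ)) →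
    Walk TriAdj (b (e + h) δ) r → Walk TriAdj s (hexes c k δ δ′ r)
  hexes-walk c zero f refl _ a w rewrite +-identityʳ c = a refl , inj₁ ab₂ , w
  hexes-walk c (suc k) f e a _ w =
    a , inj₂ (jump₀ refl (flip-sym f)) , inj₁ ab₀ , inj₂ ab₂ , inj₁ (jump₂ refl (flip-sym f)) , inj₁ ab₂ ,
    hexes-walk (suc c) k f (trans e (+-suc c k)) (inj₁ ba₀) (λ _ → inj₁ ba₂) w

  hexes-hex : ∀ c k {x δ δ′ r} → c ≤ x → x < c + k → ∃₂ λ A B → hexes c k δ δ′ r ≡ A ++ hex x δ δ′ B
  hexes-hex c zero c≤x x<c rewrite +-identityʳ c = ⊥-elim (≤⇒≯ c≤x x<c)
  hexes-hex c (suc k) {x} {δ} {δ′} c≤x x<c with m≤n⇒m<n∨m≡n c≤x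
  ... | inj₂ refl = [] , _ , refl
  ... | inj₁ c<x with hexes-hex (suc c) k {δ = δ} {δ′} c<x (subst (x <_) (+-suc c k) x<c)
  ...   | A , B , e = hex c δ δ′ A , B , cong (hex c δ δ′) e

  hexes-end : ∀ c k {e δ δ′ r} → e ≡ c + k →
    ∃ λ A → hexes c k δ δ′ r ≡ A ++ a₂ (e + h) δ ∷ b (e + h) δ ∷ r
  hexes-end c zero refl rewrite +-identityʳ c = [] , refl
  hexes-end c (suc k) {δ = δ} {δ′} e with hexes-end (suc c) k {δ = δ} {δ′} (trans e (+-suc c k))
  ... | A , e′ = hex c δ δ′ A , cong (hex c δ δ′) e′

  hexes-all : ∀ {Q : Tri → Set} {s t} c k {δ δ′ r} → s ≡ c + k → t ≡ s + h →
    (∀ {v} → index v ≤ t → Q v) → All Q r → All Q (hexes c k δ δ′ r)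
  hexes-all c zero refl refl f rs rewrite +-identityʳ c = f ≤-refl ∷ f ≤-refl ∷ rs
  hexes-all {t = t} c (suc k) refl refl f rs =
    f c+h≤ ∷ f c≤ ∷ f c≤ ∷ f c≤ ∷ f c+h≤ ∷ f c+h≤ ∷ hexes-all (suc c) k (+-suc c k) refl f rs
    where
    c+h≤ : c + h ≤ c + suc k + h
    c+h≤ = +-monoˡ-≤ h (m≤m+n c (suc k))
    c≤ : c ≤ c + suc k + h
    c≤ = ≤-trans (m≤m+n c h) c+h≤

  -- The slab is traversed in two rounds, which differ in δ; this list includes the return to the start.
  slabList : List Tri
  slabList = hexes 0 h false true (a₀ (h + h) false ∷ hexes 0 h true false (a₀ (h + h) true ∷ []))

  slab-hex : ∀ {δ δ′ x} → Flip δ δ′ → x < h → ∃₂ λ A B → slabList ≡ A ++ hex x δ δ′ B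
  slab-hex ft x<h = hexes-hex 0 h z≤n x<h
  slab-hex tf x<h with hexes-end 0 h {δ = false} {true} {a₀ (h + h) false ∷ hexes 0 h true false (a₀ (h + h) true ∷ [])} refl
  ... | A , e with hexes-hex 0 h {δ = true} {false} {a₀ (h + h) true ∷ []} z≤n x<h
  ...   | A′ , B , e′ = _ , B , trans e (trans (cong (λ l → A ++ a₂ (h + h) false ∷ b (h + h) false ∷ a₀ (h + h) false ∷ l) e′)
                          (sym (++-assoc A (a₂ (h + h) false ∷ b (h + h) false ∷ a₀ (h + h) false ∷ A′) _)))

  slab-end : ∀ δ → ∃₂ λ A B → slabList ≡ A ++ a₂ (h + h) δ ∷ b (h + h) δ ∷ a₀ (h + h) δ ∷ B
  slab-end false with hexes-end 0 h {δ = false} {true} {a₀ (h + h) false ∷ hexes 0 h true false (a₀ (h + h) true ∷ [])} refl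
  ... | A , e = A , _ , e
  slab-end true with hexes-end 0 h {δ = false} {true} {a₀ (h + h) false ∷ hexes 0 h true false (a₀ (h + h) true ∷ [])} refl
  ... | A , e with hexes-end 0 h {δ = true} {false} {a₀ (h + h) true ∷ []} refl
  ...   | A′ , e′ = _ , [] , trans e (trans (cong (λ l → A ++ a₂ (h + h) false ∷ b (h + h) false ∷ a₀ (h + h) false ∷ l) e′)
                          (sym (++-assoc A (a₂ (h + h) false ∷ b (h + h) false ∷ a₀ (h + h) false ∷ A′) _)))

  data SlabEdge : Tri → Tri → Set where
    rung : ∀ {x δ} → x < suc (h + h) → SlabEdge (a₂ x δ) (b x δ)
    side : SlabEdge (a₂ 0 false) (a₂ h true)

  halves : ∀ {x} → x < suc (h + h) → (x < h) ⊎ ((∃ λ y → y < h × x ≡ y + h) ⊎ x ≡ h + h)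
  halves {x} lt with <-≤-connex x h
  ... | inj₁ x<h = inj₁ x<h
  ... | inj₂ h≤x with m≤n⇒m<n∨m≡n (s≤s⁻¹ lt)
  ...   | inj₂ e = inj₂ (inj₂ e)
  ...   | inj₁ x<2h = inj₂ (inj₁ (x ∸ h , +-cancelʳ-< h _ _ (subst (_< h + h) (sym (m∸n+n≡m h≤x)) x<2h) , sym (m∸n+n≡m h≤x)))

  Below : ℕ → Tri → Set
  Below m v = index v < m

  slab : Cycle TriAdj (Below (suc (h + h))) (suc (h + h) * 6) SlabEdge
  slab = record
    { start = a₀ (h + h) true ; rest = rest
    ; adjacent = λ {p} {q} t → walk-steps walk (subst (λ l → Steps (a₀ (h + h) true) l p q) eq t)
    ; size = trans (cong suc (trans (hexes-length 0 h _) (cong (λ n → h * 6 + (3 + n)) (hexes-length 0 h [])))) (count h)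
    ; sound = All.lookup (s≤s ≤-refl ∷ hexes-all 0 h refl refl s≤s (s≤s ≤-refl ∷ hexes-all 0 h refl refl s≤s []))
    ; complete = λ {v} p → back (cover v p)
    ; edge = λ r → edges r }
    where
    rest = hexes 0 h false true (a₀ (h + h) false ∷ hexes 0 h true false [])
    eq : rest ++ a₀ (h + h) true ∷ [] ≡ slabList
    eq = trans (hexes-++ 0 h {false} {true} (a₀ (h + h) false ∷ hexes 0 h true false []) (a₀ (h + h) true ∷ []))
           (cong (λ l → hexes 0 h false true (a₀ (h + h) false ∷ l)) (hexes-++ 0 h {true} {false} [] (a₀ (h + h) true ∷ [])))
    count : ∀ h → suc (h * 6 + (3 + (h * 6 + 2))) ≡ suc (h + h) * 6
    count = solve-∀
    walk : Walk TriAdj (a₀ (h + h) true) slabList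
    walk = hexes-walk 0 h ft refl (inj₂ (jump₀ refl ft)) (λ ())
      (inj₂ ab₀ , hexes-walk 0 h tf refl (inj₂ (jump₀ refl tf)) (λ ()) (inj₂ ab₀ , tt))
    back : ∀ {v} → v ∈ slabList → v ∈ a₀ (h + h) true ∷ rest
    back {v} i with ∈-++⁻ rest (subst (v ∈_) (sym eq) i)
    ... | inj₁ j        = there j
    ... | inj₂ (here e) = here e
    inside : ∀ {v δ δ′ x} → Flip δ δ′ → x < h → (∀ {B} → v ∈ hex x δ δ′ B) → v ∈ slabList
    inside {v} f x<h i with slab-hex f x<h
    ... | A , B , e = subst (v ∈_) (sym e) (∈-++⁺ʳ A i)
    atEnd : ∀ {v} δ → (∀ {B} → v ∈ a₂ (h + h) δ ∷ b (h + h) δ ∷ a₀ (h + h) δ ∷ B) → v ∈ slabList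
    atEnd {v} δ i with slab-end δ
    ... | A , B , e = subst (v ∈_) (sym e) (∈-++⁺ʳ A i)
    -- A vertex over x < h is visited in the round of the opposite bit, one over x ≥ h in the round
    -- of its own bit.
    cover : ∀ v → Below (suc (h + h)) v → v ∈ slabList
    cover (a₀ x δ) lt with halves lt
    ... | inj₁ x<h                      = inside (flip-sym (flip-not δ)) x<h (there (here refl))
    ... | inj₂ (inj₁ (y , y<h , refl)) = inside (flip-not δ) y<h (here refl)
    ... | inj₂ (inj₂ refl)             = atEnd δ (there (there (here refl)))
    cover (a₂ x δ) lt with halves lt
    ... | inj₁ x<h                      = inside (flip-sym (flip-not δ)) x<h (there (there (there (here refl))))
    ... | inj₂ (inj₁ (y , y<h , refl)) = inside (flip-not δ) y<h (there (there (there (there (here refl)))))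
    ... | inj₂ (inj₂ refl)             = atEnd δ (here refl)
    cover (b x δ) lt with halves lt
    ... | inj₁ x<h                      = inside (flip-sym (flip-not δ)) x<h (there (there (here refl)))
    ... | inj₂ (inj₁ (y , y<h , refl)) = inside (flip-not δ) y<h (there (there (there (there (there (here refl))))))
    ... | inj₂ (inj₂ refl)             = atEnd δ (there (here refl))
    E : Tri → Tri → Set
    E p q = Loop (a₀ (h + h) true) rest p q
    step : ∀ {p q δ δ′ x} → Flip δ δ′ → x < h → (∀ {B} → Steps (a₀ (x + h) δ) (a₀ x δ′ ∷ b x δ′ ∷ a₂ x δ′ ∷ a₂ (x + h) δ ∷ b (x + h) δ ∷ B) p q) → E p q
    step {p} {q} f x<h s with slab-hex f x<h
    ... | A , B , e = subst (λ l → Steps (a₀ (h + h) true) l p q) (trans (sym e) (sym eq)) (steps-++ʳ A s)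
    edges : ∀ {p q} → SlabEdge p q → E p q ⊎ E q p
    edges side = inj₁ (step tf (s≤s z≤n) (later (later (later first))))
    edges (rung {x} {δ} lt) with halves lt
    ... | inj₁ x<h                      = inj₂ (step (flip-sym (flip-not δ)) x<h (later (later first)))
    ... | inj₂ (inj₁ (y , y<h , refl)) = inj₁ (step (flip-not δ) y<h (later (later (later (later first)))))
    ... | inj₂ (inj₂ refl) with slab-end δ
    ...   | A , B , e = inj₁ (subst (λ l → Steps (a₀ (h + h) true) l (a₂ (h + h) δ) (b (h + h) δ)) (trans (sym e) (sym eq)) (steps-++ʳ A first))

reindex : (ℕ → ℕ) → Tri → Tri
reindex f (a₀ x δ) = a₀ (f x) δ
reindex f (a₂ x δ) = a₂ (f x) δ
reindex f (b x δ)  = b (f x) δ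

index-reindex : ∀ f v → index (reindex f v) ≡ f (index v)
index-reindex f (a₀ _ _) = refl
index-reindex f (a₂ _ _) = refl
index-reindex f (b _ _)  = refl

unshift : ∀ {m} v → m ≤ index v → v ≡ reindex (_+ m) (reindex (_∸ m) v)
unshift (a₀ x δ) le = cong (λ z → a₀ z δ) (sym (m∸n+n≡m le))
unshift (a₂ x δ) le = cong (λ z → a₂ z δ) (sym (m∸n+n≡m le))
unshift (b x δ)  le = cong (λ z → b z δ) (sym (m∸n+n≡m le))

-- Growing the cycle on three levels to every large width

module _ (g : ℕ) where

  private
    h : ℕ
    h = suc g

  -- `inn` and `out` will link a class ρ to its neighbours, and `side` will carry a second stack
  -- above level 2. They lie over 0 and h, out of reach of the growth at the other end.
  data Base : Tri → Tri → Set where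
    inn  : Base (a₂ 0 false) (b 0 false)
    out  : Base (a₂ h true) (b h true)
    side : Base (a₂ 0 false) (a₂ h true)

  -- The window of the last h positions, exactly those from which a jump by h leaves the part
  -- already covered.
  Top : ℕ → Tri → Tri → Set
  Top m p q = ∃₂ λ x δ → m ≤ x + h × x < m × p ≡ a₂ x δ × q ≡ b x δ

  Frame : ℕ → Set
  Frame m = Cycle (TriAdj g) (Below g m) (m * 6) (λ p q → Base p q ⊎ Top m p q)

  firstSlab : Frame (suc (h + h))
  firstSlab = weaken (slab g) id id refl λ
    { (inj₁ inn) → rung (s≤s z≤n) ; (inj₁ out) → rung (s≤s (m≤m+n h h)) ; (inj₁ side) → side
    ; (inj₂ (x , δ , _ , lt , refl , refl)) → rung lt }

  shift-adj : ∀ o {p q} → TriAdj g p q → TriAdj g (reindex (_+ o) p) (reindex (_+ o) q)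
  shift-adj o = [ inj₁ ∘ go , inj₂ ∘ go ]′
    where
    up : ∀ {x y} → y ≡ x + h → y + o ≡ x + o + h
    up {x} refl = trans (+-assoc x h o) (trans (cong (x +_) (+-comm h o)) (sym (+-assoc x o h)))
    go : ∀ {p q} → TriEdge g p q → TriEdge g (reindex (_+ o) p) (reindex (_+ o) q)
    go ab₀ = ab₀
    go ab₂ = ab₂
    go ba₀ = ba₀
    go ba₂ = ba₂
    go (jump₀ e f) = jump₀ (up e) f
    go (jump₂ e f) = jump₂ (up e) f
    go (jump e f)  = jump (up e) f

  -- The jump from the last position m - 1 arrives at position g of the new slab. A jump flips the
  -- bit, so a rung with bit false is glued to one with bit true. The rung used up in the new slab
  -- lies below its top window.
  addSlab : ∀ {m} → h + h < m → Frame m → Frame (m + suc (h + h))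
  addSlab {m@(suc m′)} 2h<m C = weaken
    (merge swap C (mapCycle (reindex (_+ m)) (slab g) (λ _ _ → shift-adj m))
      (inj₂ (m′ , false , m≤ , ≤-refl , refl , refl))
      (_ , _ , rung {δ = true} (≤-trans (n≤1+n h) (s≤s (m≤m+n h h))) , refl , refl)
      (inj₁ (jump₂ eq ft)) (inj₁ (jump eq ft)))
    (λ { {v} (inj₁ lt) → <-≤-trans lt (m≤m+n m _)
       ; (inj₂ (v , lt , refl)) → subst (_< m + suc (h + h)) (sym (index-reindex (_+ m) v))
           (subst (index v + m <_) (+-comm (suc (h + h)) m) (+-monoˡ-< m lt)) })
    (λ {v} lt → case <-≤-connex (index v) m of λ
       { (inj₁ l) → inj₁ l
       ; (inj₂ le) → inj₂ (reindex (_∸ m) v ,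
           subst (_< suc (h + h)) (sym (index-reindex (_∸ m) v))
             (+-cancelʳ-< m _ _ (subst (_< suc (h + h) + m) (sym (m∸n+n≡m le)) (subst (index v <_) (+-comm m _) lt)))
           , unshift v le) })
    (sym (*-distribʳ-+ 6 m (suc (h + h))))
    λ { (inj₁ inn)  → inj₁ (inj₁ inn , apart (m′≢0 ∘ sym ∘ cong index) λ ())
      ; (inj₁ out)  → inj₁ (inj₁ out , apart (λ ()) λ ())
      ; (inj₁ side) → inj₁ (inj₁ side , apart (m′≢0 ∘ sym ∘ cong index) λ ())
      ; (inj₂ (x , δ , le , lt , refl , refl)) → let lx = low le in
          inj₂ ((a₂ (x ∸ m) δ , b (x ∸ m) δ
          , rung (+-cancelʳ-< m _ _ (subst (_< suc (h + h) + m) (sym (m∸n+n≡m (≤-trans (m≤n+m m h) (<⇒≤ lx)))) (subst (x <_) (+-comm m _) lt)))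
          , unshift (a₂ x δ) (≤-trans (m≤n+m m h) (<⇒≤ lx)) , unshift (b x δ) (≤-trans (m≤n+m m h) (<⇒≤ lx)))
          , apart (λ e → <⇒≢ (<-trans (n<1+n (g + m)) lx) (sym (cong index e))) λ ()) }
    where
    eq : g + m ≡ m′ + h
    eq = trans (+-suc g m′) (trans (cong suc (+-comm g m′)) (sym (+-suc m′ g)))
    m≤ : m ≤ m′ + h
    m≤ = subst (m ≤_) (sym (+-suc m′ g)) (s≤s (m≤m+n m′ g))
    m′≢0 : m′ ≢ 0
    m′≢0 refl = case s≤s⁻¹ 2h<m of λ ()
    low : ∀ {x} → m + suc (h + h) ≤ x + h → h + m < x
    low {x} le = +-cancelʳ-≤ h _ _ (≤-trans (≤-reflexive (solve m h)) le)
      where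
      solve : ∀ m h → suc (h + m) + h ≡ m + suc (h + h)
      solve = solve-∀

  -- The five edges that remain when a hexagon is attached by its lower rung at `a₂`. Its `high₂`
  -- rung becomes part of the next top window.
  data HexFree (c : ℕ) (δ δ′ : Bool) : Tri → Tri → Set where
    low₀  : HexFree c δ δ′ (a₀ c δ′) (b c δ′)
    high₀ : HexFree c δ δ′ (a₀ (c + h) δ) (b (c + h) δ)
    high₂ : HexFree c δ δ′ (a₂ (c + h) δ) (b (c + h) δ)
    rise₀ : HexFree c δ δ′ (a₀ c δ′) (a₀ (c + h) δ)
    rise₂ : HexFree c δ δ′ (a₂ c δ′) (a₂ (c + h) δ)

  hexCycle : ∀ {δ δ′} c → Flip δ δ′ →
    Cycle (TriAdj g) (_∈ hex g c δ δ′ []) 6 (λ p q → HexFree c δ δ′ p q ⊎ (p ≡ a₂ c δ′ × q ≡ b c δ′))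
  hexCycle c f = record
    { start = _ ; rest = _
    ; adjacent = walk-steps {Adj = TriAdj g} (inj₂ (jump₀ refl (flip-sym f)) , inj₁ ab₀ , inj₂ ab₂ , inj₁ (jump₂ refl (flip-sym f)) , inj₁ ab₂ , inj₂ ab₀ , tt)
    ; size = refl ; sound = id ; complete = id
    ; edge = λ { (inj₁ low₀) → inj₁ (later first)
               ; (inj₁ high₀) → inj₂ (later (later (later (later (later first)))))
               ; (inj₁ high₂) → inj₁ (later (later (later (later first))))
               ; (inj₁ rise₀) → inj₂ first
               ; (inj₁ rise₂) → inj₁ (later (later (later first)))
               ; (inj₂ (refl , refl)) → inj₂ (later (later first)) } }

  module _ (m₀ : ℕ) where

    private
      m : ℕ
      m = m₀ + h

    hex-far : ∀ {i j δ δ′ ε p q} → j < h → HexFree (i + m) δ δ′ p q → ¬ Same p q (a₂ (j + m₀) ε) (b (j + m₀) ε)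
    hex-far {i} {j} l = λ
      { low₀ → apart (λ ()) λ () ; high₀ → apart (λ ()) λ () ; rise₀ → apart (λ ()) λ ()
      ; high₂ → apart (far h ∘ cong index) λ ()
      ; rise₂ → apart (far 0 ∘ trans (+-identityʳ _) ∘ cong index) λ () }
      where
      far : ∀ k → i + m + k ≢ j + m₀
      far k e = <⇒≢ (<-≤-trans (subst (j + m₀ <_) (+-comm h m₀) (+-monoˡ-< m₀ l)) (≤-trans (m≤n+m m i) (m≤m+n (i + m) k))) (sym e)

    -- Every rung with bit δ in the top window carries one hexagon, reached by a jump. Two such
    -- rows, one for each bit, fill the next 2h positions.
    addHexRow : ∀ {δ δ′ P₀ N₀} {R₀ F₀ : Tri → Tri → Set} → Flip δ δ′ → Cycle (TriAdj g) P₀ N₀ R₀ →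
      (∀ {j} → j < h → R₀ (a₂ (j + m₀) δ) (b (j + m₀) δ)) → (∀ {p q} → F₀ p q → R₀ p q) →
      (∀ {j p q} → j < h → F₀ p q → ¬ Same p q (a₂ (j + m₀) δ) (b (j + m₀) δ)) →
      Cycle (TriAdj g) (λ v → P₀ v ⊎ ∃ λ j → j < h × v ∈ hex g (j + m) δ δ′ []) (N₀ + h * 6)
        (λ p q → F₀ p q ⊎ ∃ λ j → j < h × HexFree (j + m) δ δ′ p q)
    addHexRow {δ} {δ′} f C tops sub f₀ =
      star swap h C (λ {j} _ → hexCycle (j + m) f) tops (inj₂ (refl , refl))
        (λ {j} → inj₁ (jump₂ (sym (+-assoc j m₀ h)) f)) (λ {j} → inj₁ (jump (sym (+-assoc j m₀ h)) f))
        (λ ne → apart (λ e → ne (+-cancelʳ-≡ m₀ _ _ (cong index e))) λ ())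
        sub f₀ inj₁ (λ {j} → fi {j}) (λ {i} _ l → hex-far {i} l)
      where
      fi : ∀ {j p q} → HexFree (j + m) δ δ′ p q → ¬ Same p q (a₂ (j + m) δ′) (b (j + m) δ′)
      fi low₀  = apart (λ ()) λ ()
      fi high₀ = apart (λ ()) λ ()
      fi high₂ = apart (m≢1+m+n _ ∘ sym ∘ trans (sym (+-suc _ g)) ∘ cong index) λ ()
      fi rise₀ = apart (λ ()) λ ()
      fi rise₂ = λ { (inj₁ (_ , ())) ; (inj₂ (() , _)) }

    NewHex : Tri → Tri → Set
    NewHex p q = ∃ λ j → j < h × ∃₂ λ δ δ′ → Flip δ δ′ × HexFree (j + m) δ δ′ p q

    addHexes : h < m₀ → Frame m →
      Cycle (TriAdj g) (Below g (m + (h + h))) ((m + (h + h)) * 6) (λ p q → Base p q ⊎ NewHex p q)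
    addHexes h<m₀ C = weaken
      (addHexRow {F₀ = λ p q → Base p q ⊎ (∃ λ j → j < h × HexFree (j + m) false true p q)} tf
        (addHexRow {F₀ = λ p q → Base p q ⊎ (∃ λ j → j < h × p ≡ a₂ (j + m₀) true × q ≡ b (j + m₀) true)} ft C
          tops [ inj₁ , (λ { (j , l , refl , refl) → tops l }) ]′
          (λ { l (inj₁ r) → baseFar r ; l (inj₂ (_ , _ , refl , refl)) → apart (λ ()) λ () }))
        (λ {j} l → inj₁ (inj₂ (j , l , refl , refl)))
        [ inj₁ ∘ inj₁ , inj₂ ]′
        (λ { l (inj₁ r) → baseFar r ; l (inj₂ (i , _ , r)) → hex-far {i} l r }))
      to from
      (count m h)
      λ { (inj₁ r) → inj₁ (inj₁ r)
        ; (inj₂ (j , l , _ , _ , ft , r)) → inj₁ (inj₂ (j , l , r))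
        ; (inj₂ (j , l , _ , _ , tf , r)) → inj₂ (j , l , r) }
      where
      count : ∀ m h → m * 6 + h * 6 + h * 6 ≡ (m + (h + h)) * 6
      count = solve-∀
      tops : ∀ {j δ} → j < h → Base (a₂ (j + m₀) δ) (b (j + m₀) δ) ⊎ Top m (a₂ (j + m₀) δ) (b (j + m₀) δ)
      tops {j} {δ} l = inj₂ (j + m₀ , δ , +-monoˡ-≤ h (m≤n+m m₀ j)
        , subst (j + m₀ <_) (+-comm h m₀) (+-monoˡ-< m₀ l) , refl , refl)
      baseFar : ∀ {j δ p q} → Base p q → ¬ Same p q (a₂ (j + m₀) δ) (b (j + m₀) δ)
      baseFar {j} inn  = apart (λ e → <⇒≢ (<-≤-trans (≤-trans (s≤s z≤n) h<m₀) (m≤n+m m₀ j)) (cong index e)) λ ()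
      baseFar {j} out  = apart (λ e → <⇒≢ (<-≤-trans h<m₀ (m≤n+m m₀ j)) (cong index e)) λ ()
      baseFar {j} side = apart (λ e → <⇒≢ (<-≤-trans (≤-trans (s≤s z≤n) h<m₀) (m≤n+m m₀ j)) (cong index e)) λ ()
      bound : ∀ {j} → j < h → j + m + h < m + (h + h)
      bound {j} l = subst (j + m + h <_) (trans (cong (_+ h) (+-comm h m)) (+-assoc m h h)) (+-monoˡ-< h (+-monoˡ-< m l))
      inHex : ∀ {j δ δ′ v} → j < h → v ∈ hex g (j + m) δ δ′ [] → index v < m + (h + h)
      inHex {j} l = All.lookup {P = Below g (m + (h + h))} (hi ∷ lo ∷ lo ∷ lo ∷ hi ∷ hi ∷ [])
        where
        hi = bound l
        lo = ≤-<-trans (m≤m+n (j + m) h) hi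
      to : ∀ {v} → ((Below g m v ⊎ (∃ λ j → j < h × v ∈ hex g (j + m) false true [])) ⊎ (∃ λ j → j < h × v ∈ hex g (j + m) true false [])) → Below g (m + (h + h)) v
      to (inj₁ (inj₁ l)) = <-≤-trans l (m≤m+n m _)
      to (inj₁ (inj₂ (j , l , i))) = inHex l i
      to (inj₂ (j , l , i)) = inHex l i
      pick : ∀ {v δ δ′ j} → Flip δ δ′ → j < h → v ∈ hex g (j + m) δ δ′ [] →
        (Below g m v ⊎ (∃ λ j → j < h × v ∈ hex g (j + m) false true [])) ⊎ (∃ λ j → j < h × v ∈ hex g (j + m) true false [])
      pick ft l i = inj₁ (inj₂ (_ , l , i))
      pick tf l i = inj₂ (_ , l , i)
      split : ∀ {x} → m ≤ x → x < m + (h + h) → ∃ λ j → j < h × (x ≡ j + m ⊎ x ≡ j + m + h)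
      split {x} le lt with <-≤-connex (x ∸ m) h
      ... | inj₁ l = x ∸ m , l , inj₁ (sym (m∸n+n≡m le))
      ... | inj₂ l = x ∸ m ∸ h
        , +-cancelʳ-< h _ _ (subst (_< h + h) (sym (m∸n+n≡m l)) (+-cancelʳ-< m _ _ (subst (_< h + h + m) (sym (m∸n+n≡m le)) (subst (x <_) (+-comm m (h + h)) lt))))
        , inj₂ (sym (trans (trans (+-assoc (x ∸ m ∸ h) m h) (trans (cong (x ∸ m ∸ h +_) (+-comm m h)) (sym (+-assoc (x ∸ m ∸ h) h m)))) (trans (cong (_+ m) (m∸n+n≡m l)) (m∸n+n≡m le))))
      from : ∀ {v} → Below g (m + (h + h)) v → (Below g m v ⊎ (∃ λ j → j < h × v ∈ hex g (j + m) false true [])) ⊎ (∃ λ j → j < h × v ∈ hex g (j + m) true false [])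
      from {v} lt with <-≤-connex (index v) m
      ... | inj₁ l = inj₁ (inj₁ l)
      from {a₀ x δ} lt | inj₂ le with split le lt
      ... | j , l , inj₁ refl = pick (flip-sym (flip-not δ)) l (there (here refl))
      ... | j , l , inj₂ refl = pick (flip-not δ) l (here refl)
      from {a₂ x δ} lt | inj₂ le with split le lt
      ... | j , l , inj₁ refl = pick (flip-sym (flip-not δ)) l (there (there (there (here refl))))
      ... | j , l , inj₂ refl = pick (flip-not δ) l (there (there (there (there (here refl)))))
      from {b x δ} lt | inj₂ le with split le lt
      ... | j , l , inj₁ refl = pick (flip-sym (flip-not δ)) l (there (there (here refl)))
      ... | j , l , inj₂ refl = pick (flip-not δ) l (there (there (there (there (there (here refl))))))

    newTop : ∀ {p q} → Top (m + (h + h)) p q → NewHex p q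
    newTop (x , δ , le , lt , refl , refl) = j
      , +-cancelʳ-< (m + h) j h (subst (_< h + (m + h)) (sym eq) (subst (x <_) (arith m h) lt))
      , δ , not δ , flip-not δ
      , subst (λ z → HexFree (j + m) δ (not δ) (a₂ z δ) (b z δ)) (trans (+-assoc j m h) eq) high₂
      where
      arith : ∀ m h → m + (h + h) ≡ h + (m + h)
      arith = solve-∀
      m+h≤x : m + h ≤ x
      m+h≤x = +-cancelʳ-≤ h _ _ (subst (_≤ x + h) (sym (+-assoc m h h)) le)
      j : ℕ
      j = x ∸ (m + h)
      eq : j + (m + h) ≡ x
      eq = m∸n+n≡m m+h≤x

  extend : ∀ {m} → h + h < m → Frame m → Frame (m + (h + h))
  extend {m} lt C = subst Frame (cong (_+ (h + h)) eq)
    (weaken (addHexes (m ∸ h) (+-cancelʳ-< h _ _ (subst (h + h <_) (sym eq) lt)) (subst Frame (sym eq) C)) id id refl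
      [ inj₁ , inj₂ ∘ newTop (m ∸ h) ]′)
    where
    eq : m ∸ h + h ≡ m
    eq = m∸n+n≡m (≤-trans (m≤m+n h h) (<⇒≤ lt))

  slabs : ∀ v → Frame (suc v * suc (h + h))
  slabs zero    = subst Frame (sym (+-identityʳ _)) firstSlab
  slabs (suc v) = subst Frame (+-comm (suc v * suc (h + h)) (suc (h + h))) (addSlab (m≤m+n (suc (h + h)) (v * suc (h + h))) (slabs v))

  frame : ∀ v u → Frame (suc v * suc (h + h) + u * (h + h))
  frame v zero    = subst Frame (sym (+-identityʳ _)) (slabs v)
  frame v (suc u) = subst Frame (arith (suc v * suc (h + h)) u (h + h))
    (extend (≤-trans (m≤m+n (suc (h + h)) (v * suc (h + h))) (m≤m+n (suc v * suc (h + h)) (u * (h + h)))) (frame v u))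
    where
    arith : ∀ s u k → s + u * k + k ≡ s + (k + u * k)
    arith = solve-∀

  -- `up` will carry the next band of levels, and `down` is where a reflected stack is attached from
  -- below. `rung₀` and `roof₀` become a displaced pair for the passage to higher dimension; `rung₀`
  -- also joins the two halves of the board.
  data Mark (β : ℕ) : Tri → Tri → Set where
    base  : ∀ {p q} → Base p q → Mark β p q
    rung₀ : ∀ {δ} → Mark β (a₀ β δ) (b β δ)
    roof₀ : ∀ {δ} → Mark β (a₀ (β + h) δ) (b (β + h) δ)
    up    : ∀ {δ δ′} → Flip δ δ′ → Mark β (a₂ β δ) (a₂ (β + h) δ′)
    down  : ∀ {δ δ′} → Flip δ δ′ → Mark β (a₀ β δ) (a₀ (β + h) δ′)

  -- The marked edges outside `Base` all belong to the last two hexagons, those over β and β + h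
  -- with either choice of bits. Hence the growth has to finish with a group of hexagons, which is
  -- the reason for `suc u`.
  threeLevels : ∀ v u {β} → suc (β + h) ≡ suc v * suc (h + h) + suc u * (h + h) →
    Cycle (TriAdj g) (Below g (suc (β + h))) (suc (β + h) * 6) (Mark β)
  threeLevels v u {β} e = weaken
    (addHexes (M ∸ h) (+-cancelʳ-< h _ _ (subst (h + h <_) (sym eq) 2h<M)) (subst Frame (sym eq) (frame v u)))
    (λ {w} → subst (index w <_) size) (λ {w} → subst (index w <_) (sym size)) (cong (_* 6) size)
    λ { (base r) → inj₁ r
      ; (rung₀ {δ}) → inj₂ (g , ≤-refl , not δ , δ , flip-sym (flip-not δ) , subst (λ c → HexFree (g + (M ∸ h + h)) (not δ) δ (a₀ c δ) (b c δ)) βeq low₀)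
      ; (roof₀ {δ}) → inj₂ (g , ≤-refl , δ , not δ , flip-not δ , subst (λ c → HexFree (g + (M ∸ h + h)) δ (not δ) (a₀ (c + h) δ) (b (c + h) δ)) βeq high₀)
      ; (up {δ} {δ′} f) → inj₂ (g , ≤-refl , δ′ , δ , flip-sym f , subst (λ c → HexFree (g + (M ∸ h + h)) δ′ δ (a₂ c δ) (a₂ (c + h) δ′)) βeq rise₂)
      ; (down {δ} {δ′} f) → inj₂ (g , ≤-refl , δ′ , δ , flip-sym f , subst (λ c → HexFree (g + (M ∸ h + h)) δ′ δ (a₀ c δ) (a₀ (c + h) δ′)) βeq rise₀) }
    where
    M : ℕ
    M = suc v * suc (h + h) + u * (h + h)
    2h<M : h + h < M
    2h<M = ≤-trans (m≤m+n (suc (h + h)) (v * suc (h + h))) (m≤m+n (suc v * suc (h + h)) (u * (h + h)))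
    eq : M ∸ h + h ≡ M
    eq = m∸n+n≡m (≤-trans (m≤m+n h h) (<⇒≤ 2h<M))
    arith : ∀ s u k → s + u * k + k ≡ s + (k + u * k)
    arith = solve-∀
    size : M ∸ h + h + (h + h) ≡ suc (β + h)
    size = trans (cong (_+ (h + h)) eq) (trans (arith (suc v * suc (h + h)) u (h + h)) (sym e))
    βeq : g + (M ∸ h + h) ≡ β
    βeq = +-cancelʳ-≡ (suc h) _ _ (trans (arith′ (M ∸ h + h) g) (trans size (sym (+-suc β h))))
      where
      arith′ : ∀ s g → g + s + suc (suc g) ≡ s + (suc g + suc g)
      arith′ = solve-∀

-- Two levels

-- ev x δ and od x δ have first coordinates 2x and 2x + 1; their levels differ by one.
data Duo : Set where
  ev od : ℕ → Bool → Duo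

pos : Duo → ℕ
pos (ev x _) = x
pos (od x _) = x

bit : Duo → Bool
bit (ev _ δ) = δ
bit (od _ δ) = δ

-- Along these cycles the bit δ is a function c of x.
module _ (g : ℕ) (c : ℕ → Bool) (c-flip : ∀ x → Flip (c x) (c (x + suc g))) (c-const : ∀ x → x < g → c (suc x) ≡ c x) where

  private
    h : ℕ
    h = suc g

  data DuoEdge : Duo → Duo → Set where
    eo : ∀ {x δ} → DuoEdge (ev x δ) (od x δ)
    oe : ∀ {x δ} → DuoEdge (od x δ) (ev (suc x) δ)
    jumpE : ∀ {x δ δ′} → Flip δ δ′ → DuoEdge (ev x δ) (ev (x + h) δ′)
    jumpO : ∀ {x δ δ′} → Flip δ δ′ → DuoEdge (od x δ) (od (x + h) δ′)

  DuoAdj : Duo → Duo → Set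
  DuoAdj p q = DuoEdge p q ⊎ DuoEdge q p

  Coloured : ℕ → Duo → Set
  Coloured m (ev x δ) = x < m × δ ≡ c x
  Coloured m (od x δ) = x < m × δ ≡ c x

  quad : ℕ → List Duo
  quad i = ev i (c i) ∷ ev (i + h) (c (i + h)) ∷ od (i + h) (c (i + h)) ∷ od i (c i) ∷ []

  data QuadEdge (i : ℕ) : Duo → Duo → Set where
    ee : QuadEdge i (ev i (c i)) (ev (i + h) (c (i + h)))
    oo : QuadEdge i (od i (c i)) (od (i + h) (c (i + h)))
    rg : QuadEdge i (ev (i + h) (c (i + h))) (od (i + h) (c (i + h)))

  quadCycle : ∀ i → Cycle DuoAdj (_∈ quad i) 4 (QuadEdge i)
  quadCycle i = record
    { start = _ ; rest = _
    ; adjacent = walk-steps {Adj = DuoAdj} (inj₁ (jumpE (c-flip i)) , inj₁ eo , inj₂ (jumpO (c-flip i)) , inj₂ eo , tt)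
    ; size = refl ; sound = id ; complete = id
    ; edge = λ { ee → inj₁ first ; oo → inj₂ (later (later first)) ; rg → inj₁ (later first) } }

  -- Neighbouring 4-cycles are glued by steps from `od k` to `ev (suc k)` and the same steps h
  -- further on. Steps keep the bit, so `c` has to be constant on the first h positions.
  quads : ∀ k → k < h → Cycle DuoAdj (λ v → ∃ λ i → i ≤ k × v ∈ quad i) (suc k * 4)
    (λ p q → (∃ λ i → i ≤ k × p ≡ ev (i + h) (c (i + h)) × q ≡ od (i + h) (c (i + h)))
           ⊎ (p ≡ od k (c k) × q ≡ od (k + h) (c (k + h))))
  quads zero _ = weaken (quadCycle 0) (λ i → 0 , z≤n , i) (λ { (_ , z≤n , i) → i }) refl λ
    { (inj₁ (_ , z≤n , refl , refl)) → rg ; (inj₂ (refl , refl)) → oo }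
  quads (suc k) k<h = weaken
    (merge swap (quads k (<⇒≤ k<h)) (quadCycle (suc k)) (inj₂ (refl , refl)) ee
      (adj k (c-const k (s≤s⁻¹ k<h))) (adj (k + h) high))
    (λ { (inj₁ (i , le , w)) → i , m≤n⇒m≤1+n le , w ; (inj₂ w) → suc k , ≤-refl , w })
    (λ { (i , le , w) → case m≤n⇒m<n∨m≡n le of λ { (inj₁ lt) → inj₁ (i , s≤s⁻¹ lt , w) ; (inj₂ refl) → inj₂ w } })
    (+-comm (suc k * 4) 4)
    λ { (inj₁ (i , le , refl , refl)) → case m≤n⇒m<n∨m≡n le of λ
          { (inj₁ lt) → inj₁ (inj₁ (i , s≤s⁻¹ lt , refl , refl) , apart (λ ()) λ ())
          ; (inj₂ refl) → inj₂ (rg , λ { (inj₁ (_ , ())) ; (inj₂ (_ , ())) }) }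
      ; (inj₂ (refl , refl)) → inj₂ (oo , apart (λ ()) λ ()) }
    where
    adj : ∀ x → c (suc x) ≡ c x → DuoAdj (od x (c x)) (ev (suc x) (c (suc x)))
    adj x e = subst (λ δ → DuoAdj (od x (c x)) (ev (suc x) δ)) (sym e) (inj₁ oe)
    high : c (suc k + h) ≡ c (k + h)
    high = flip-det (c-flip (suc k)) (subst (λ δ → Flip δ (c (k + h))) (sym (c-const k (s≤s⁻¹ k<h))) (c-flip k))

  Rung : ℕ → Duo → Duo → Set
  Rung m p q = ∃ λ x → m ≤ x + h × x < m × p ≡ ev x (c x) × q ≡ od x (c x)

  duoStart : Cycle DuoAdj (Coloured (h + h)) ((h + h) * 2) (Rung (h + h))
  duoStart = weaken (quads g ≤-refl) to from (count h) λ
    { (x , le , lt , refl , refl) → inj₁ (x ∸ h , s≤s⁻¹ (+-cancelʳ-< h _ _ (subst (_< h + h) (sym (above le)) lt))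
      , cong (λ z → ev z (c z)) (sym (above le)) , cong (λ z → od z (c z)) (sym (above le))) }
    where
    count : ∀ h → h * 4 ≡ (h + h) * 2
    count = solve-∀
    above : ∀ {x} → h + h ≤ x + h → x ∸ h + h ≡ x
    above {x} le = m∸n+n≡m (+-cancelʳ-≤ h h x le)
    to : ∀ {v} → (∃ λ i → i ≤ g × v ∈ quad i) → Coloured (h + h) v
    to (i , le , here refl) = ≤-trans (s≤s le) (m≤m+n h h) , refl
    to (i , le , there (here refl)) = +-monoˡ-< h (s≤s le) , refl
    to (i , le , there (there (here refl))) = +-monoˡ-< h (s≤s le) , refl
    to (i , le , there (there (there (here refl)))) = ≤-trans (s≤s le) (m≤m+n h h) , refl
    split : ∀ {x} → x < h + h → (∃ λ i → i ≤ g × (x ≡ i ⊎ x ≡ i + h))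
    split {x} lt with <-≤-connex x h
    ... | inj₁ l = x , s≤s⁻¹ l , inj₁ refl
    ... | inj₂ l = x ∸ h , s≤s⁻¹ (+-cancelʳ-< h _ _ (subst (_< h + h) (sym (m∸n+n≡m l)) lt)) , inj₂ (sym (m∸n+n≡m l))
    from : ∀ {v} → Coloured (h + h) v → ∃ λ i → i ≤ g × v ∈ quad i
    from {ev x _} (lt , refl) with split lt
    ... | i , le , inj₁ refl = i , le , here refl
    ... | i , le , inj₂ refl = i , le , there (here refl)
    from {od x _} (lt , refl) with split lt
    ... | i , le , inj₁ refl = i , le , there (there (there (here refl)))
    ... | i , le , inj₂ refl = i , le , there (there (here refl))

  Rise : ℕ → Duo → Duo → Set
  Rise x p q = (p ≡ ev x (c x) × q ≡ ev (x + h) (c (x + h))) ⊎ (p ≡ od x (c x) × q ≡ od (x + h) (c (x + h)))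

  -- The lowest rung of the window is replaced by two jumps and a new rung at x + h, so the window
  -- slides by one. The two jumps are the `Rise` edges.
  addDomino : ∀ x → Cycle DuoAdj (Coloured (x + h)) ((x + h) * 2) (Rung (x + h)) →
    Cycle DuoAdj (Coloured (suc (x + h))) (suc (x + h) * 2) (λ p q → Rung (suc (x + h)) p q ⊎ Rise x p q)
  addDomino x C = weaken
    (insert swap C (x , ≤-refl , m<m+n x (s≤s z≤n) , refl , refl) (inj₁ (jumpE (c-flip x))) (inj₁ eo) (inj₁ (jumpO (c-flip x))))
    to from
    (+-comm ((x + h) * 2) 2)
    λ { (inj₂ r) → inj₂ (inj₂ r)
      ; (inj₁ (y , le , lt , refl , refl)) → case m≤n⇒m<n∨m≡n (s≤s⁻¹ lt) of λ
          { (inj₂ refl) → inj₂ (inj₁ (refl , refl))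
          ; (inj₁ l) → inj₁ ((y , <⇒≤ le , l , refl , refl)
              , apart (λ e → <⇒≢ (+-cancelʳ-< h _ _ le) (sym (cong pos e))) λ ()) } }
    where
    to : ∀ {v} → Coloured (x + h) v ⊎ (v ≡ ev (x + h) (c (x + h)) ⊎ v ≡ od (x + h) (c (x + h))) → Coloured (suc (x + h)) v
    to {ev y δ} (inj₁ (lt , e)) = m≤n⇒m≤1+n lt , e
    to {od y δ} (inj₁ (lt , e)) = m≤n⇒m≤1+n lt , e
    to (inj₂ (inj₁ refl)) = ≤-refl , refl
    to (inj₂ (inj₂ refl)) = ≤-refl , refl
    from : ∀ {v} → Coloured (suc (x + h)) v → Coloured (x + h) v ⊎ (v ≡ ev (x + h) (c (x + h)) ⊎ v ≡ od (x + h) (c (x + h)))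
    from {ev y _} (lt , refl) with m≤n⇒m<n∨m≡n (s≤s⁻¹ lt)
    ... | inj₁ l    = inj₁ (l , refl)
    ... | inj₂ refl = inj₂ (inj₁ refl)
    from {od y _} (lt , refl) with m≤n⇒m<n∨m≡n (s≤s⁻¹ lt)
    ... | inj₁ l    = inj₁ (l , refl)
    ... | inj₂ refl = inj₂ (inj₂ refl)

  dominoes : ∀ k → Cycle DuoAdj (Coloured (k + h + h)) ((k + h + h) * 2) (Rung (k + h + h))
  dominoes zero    = duoStart
  dominoes (suc k) = weaken (addDomino (k + h) (dominoes k)) id id refl inj₁

  twoLevels : ∀ {β} → h ≤ β → Cycle DuoAdj (Coloured (suc (β + h))) (suc (β + h) * 2) (Rise β)
  twoLevels {β} h≤β = weaken (addDomino β (subst (λ z → Cycle DuoAdj (Coloured (z + h)) ((z + h) * 2) (Rung (z + h)))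
    (m∸n+n≡m h≤β) (dominoes (β ∸ h)))) id id refl inj₂

-- Stacks of levels

par : ℕ → Bool
par zero    = false
par (suc n) = not (par n)

data Half : ℕ → Set where
  even : ∀ x → Half (x + x)
  odd  : ∀ x → Half (suc (x + x))

half : ∀ n → Half n
half zero    = even 0
half (suc n) with half n
... | even x = odd x
... | odd x  = subst Half (cong suc (+-suc x x)) (even (suc x))

not-not : ∀ δ → not (not δ) ≡ δ
not-not false = refl
not-not true  = refl

par-even : ∀ x → par (x + x) ≡ false
par-even zero    = refl
par-even (suc x) = trans (cong (not ∘ par) (+-suc x x)) (trans (not-not _) (par-even x))

double-< : ∀ {x m} → x + x < m + m → x < m
double-< {x} {m} lt with <-≤-connex x m
... | inj₁ l = l
... | inj₂ l = ⊥-elim (<⇒≱ lt (+-mono-≤ l l))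

double-mono-< : ∀ {x m} → x < m → suc (x + x) < m + m
double-mono-< {x} {m} l = subst (_≤ m + m) (cong suc (+-suc x x)) (+-mono-≤ l l)

Dist : ℕ → ℕ → ℕ → Set
Dist k x y = y ≡ x + k ⊎ x ≡ y + k

dist-sym : ∀ {k x y} → Dist k x y → Dist k y x
dist-sym = swap

reflect : ∀ {N k x y} → x ≤ N → y ≤ N → Dist k x y → Dist k (N ∸ x) (N ∸ y)
reflect {N} {k} {x} _ le (inj₁ refl) = inj₂ (sym (trans (cong (_+ k) (sym (∸-+-assoc N x k))) (m∸n+n≡m (m+n≤o⇒m≤o∸n k (subst (_≤ N) (+-comm x k) le)))))
reflect {N} {k} {x} {y} le _ (inj₂ refl) = inj₁ (sym (trans (cong (_+ k) (sym (∸-+-assoc N y k))) (m∸n+n≡m (m+n≤o⇒m≤o∸n k (subst (_≤ N) (+-comm y k) le)))))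

par-+ : ∀ x y → par (x + y) ≡ (par x xor par y)
par-+ zero    y = refl
par-+ (suc x) y = trans (cong not (par-+ x y)) (not-xor (par x) (par y))
  where
  not-xor : ∀ δ ε → not (δ xor ε) ≡ (not δ xor ε)
  not-xor false ε = refl
  not-xor true  ε = not-not ε

par-reflect : ∀ {N x} → x ≤ N → par N ≡ true → par (N ∸ x) ≡ not (par x)
par-reflect {N} {x} le e = xor-true (par x) (par (N ∸ x)) (trans (sym (par-+ x (N ∸ x))) (trans (cong par (m+[n∸m]≡n le)) e))
  where
  xor-true : ∀ δ ε → (δ xor ε) ≡ true → ε ≡ not δ
  xor-true false true  _ = refl
  xor-true true  false _ = refl

-- (X , j , δ) stands for the square (X , 2(ρ + j h) + δ), where ρ < h is fixed and a = 2h.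
Cell : Set
Cell = ℕ × ℕ × Bool

level : Cell → ℕ
level (_ , j , _) = j

-- `merge` pairs the ends of its edges in a fixed order, which a reflection of the board may
-- reverse.
symmetrise : ∀ {V : Set} {Adj : V → V → Set} {P N R} → Cycle Adj P N R → Cycle Adj P N (λ p q → R p q ⊎ R q p)
symmetrise C = record
  { start = start ; rest = rest ; adjacent = adjacent ; size = size ; sound = sound ; complete = complete
  ; edge = [ edge , swap ∘ edge ]′ }
  where open Cycle C

module _ (g : ℕ) where

  private
    h : ℕ
    h = suc g

  data CellAdj : Cell → Cell → Set where
    step : ∀ {X X′ j j′ δ} → Dist 1 X X′ → Dist 1 j j′ → CellAdj (X , j , δ) (X′ , j′ , δ)
    leap : ∀ {X X′ j δ δ′} → Dist (h + h) X X′ → Flip δ δ′ → CellAdj (X , j , δ) (X′ , j , δ′)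

  cell-sym : ∀ {p q} → CellAdj p q → CellAdj q p
  cell-sym (step d e) = step (dist-sym d) (dist-sym e)
  cell-sym (leap d f) = leap (dist-sym d) (flip-sym f)

  double-h : ∀ x → (x + h) + (x + h) ≡ (x + x) + (h + h)
  double-h x = arith x h
    where
    arith : ∀ x h → (x + h) + (x + h) ≡ (x + x) + (h + h)
    arith = solve-∀

  placeTri : Tri → Cell
  placeTri (a₀ x δ) = x + x , 0 , δ
  placeTri (a₂ x δ) = x + x , 2 , δ
  placeTri (b x δ)  = suc (x + x) , 1 , δ

  double-suc : ∀ x → suc x + suc x ≡ suc (x + x) + 1
  double-suc x = trans (cong suc (+-suc x x)) (+-comm 1 (suc (x + x)))

  placeTri-adj : ∀ {p q} → TriAdj g p q → CellAdj (placeTri p) (placeTri q)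
  placeTri-adj = [ go , cell-sym ∘ go ]′
    where
    go : ∀ {p q} → TriEdge g p q → CellAdj (placeTri p) (placeTri q)
    go (ab₀ {x}) = step (inj₁ (+-comm 1 (x + x))) (inj₁ refl)
    go (ab₂ {x}) = step (inj₁ (+-comm 1 (x + x))) (inj₂ refl)
    go (ba₀ {x}) = step (inj₁ (double-suc x)) (inj₂ refl)
    go (ba₂ {x}) = step (inj₁ (double-suc x)) (inj₁ refl)
    go (jump₀ {x} refl f) = leap (inj₁ (double-h x)) f
    go (jump₂ {x} refl f) = leap (inj₁ (double-h x)) f
    go (jump {x} refl f)  = leap (inj₁ (cong suc (double-h x))) f

  -- Blocks of h positions alternate, so every jump flips the bit. The two choices of the first
  -- argument give complementary cycles.
  colour : Bool → ℕ → Bool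
  colour false x = par (x / h)
  colour true  x = not (par (x / h))

  colour-flip : ∀ δ x → Flip (colour δ x) (colour δ (x + h))
  colour-flip δ x = go δ (trans (m/n≡1+[m∸n]/n (m≤n+m h x)) (cong (λ z → suc (z / h)) (m+n∸n≡m x h)))
    where
    go : ∀ δ → (x + h) / h ≡ suc (x / h) → Flip (colour δ x) (colour δ (x + h))
    go false e rewrite e = flip-not _
    go true  e rewrite e = flip-not _

  colour-const : ∀ δ x → x < g → colour δ (suc x) ≡ colour δ x
  colour-const δ x l = go δ (trans (m<n⇒m/n≡0 (s≤s l)) (sym (m<n⇒m/n≡0 (m≤n⇒m≤1+n l))))
    where
    go : ∀ δ → suc x / h ≡ x / h → colour δ (suc x) ≡ colour δ x
    go false e = cong par e
    go true  e = cong (not ∘ par) e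

  colour-total : ∀ δ x → δ ≡ colour false x ⊎ δ ≡ colour true x
  colour-total δ x = go δ (par (x / h))
    where
    go : ∀ δ ε → δ ≡ ε ⊎ δ ≡ not ε
    go false false = inj₁ refl
    go false true  = inj₂ refl
    go true  false = inj₂ refl
    go true  true  = inj₁ refl

  placeDuo : ℕ → Duo → Cell
  placeDuo e (ev x δ) = x + x , suc e , δ
  placeDuo e (od x δ) = suc (x + x) , e , δ

  DuoAdj′ : Bool → Duo → Duo → Set
  DuoAdj′ δ = DuoAdj g (colour δ) (colour-flip δ) (colour-const δ)

  placeDuo-adj : ∀ δ e {p q} → DuoAdj′ δ p q → CellAdj (placeDuo e p) (placeDuo e q)
  placeDuo-adj δ e = [ go , cell-sym ∘ go ]′
    where
    go : ∀ {p q} → DuoEdge g (colour δ) (colour-flip δ) (colour-const δ) p q → CellAdj (placeDuo e p) (placeDuo e q)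
    go (eo {x}) = step (inj₁ (+-comm 1 (x + x))) (inj₂ (+-comm 1 e))
    go (oe {x}) = step (inj₁ (double-suc x)) (inj₁ (+-comm 1 e))
    go (jumpE {x} f) = leap (inj₁ (double-h x)) f
    go (jumpO {x} f) = leap (inj₁ (cong suc (double-h x))) f

  -- The last position is m - 1 = β + h, so β is the one from which a jump reaches the end.
  module _ (β : ℕ) (h≤β : h ≤ β) where

    private
      m n : ℕ
      m = suc (β + h)
      n = m + m

    -- One of the two parity classes. As n is even, X ↦ n - 1 - X changes parity, and the other
    -- class is the mirror image.
    Levels : ℕ → Cell → Set
    Levels l (X , j , _) = X < n × j < l × par X ≡ par j

    data Kept : Cell → Cell → Set where
      inn  : Kept (0 , 2 , false) (1 , 1 , false)
      out  : Kept (h + h , 2 , true) (suc (h + h) , 1 , true)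
      rung : ∀ {δ} → Kept (β + β , 0 , δ) (suc (β + β) , 1 , δ)
      roof : ∀ {δ} → Kept ((β + h) + (β + h) , 0 , δ) (suc ((β + h) + (β + h)) , 1 , δ)
      down : ∀ {δ δ′} → Flip δ δ′ → Kept (β + β , 0 , δ) ((β + h) + (β + h) , 0 , δ′)

    Up : ℕ → Cell → Cell → Set
    Up e p q = ∃₂ λ δ δ′ → Flip δ δ′ × p ≡ (β + β , e , δ) × q ≡ ((β + h) + (β + h) , e , δ′)

    Side : Cell → Cell → Set
    Side p q = p ≡ (0 , 2 , false) × q ≡ (h + h , 2 , true)

    -- Each kept edge has an end on level 0 or 1, whereas stacking cuts the lower part only along
    -- edges inside a level from 2 on.
    kept-low : ∀ {p q u v} → Kept p q → 2 ≤ level u → 2 ≤ level v → ¬ Same p q u v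
    kept-low {u = u} {v} k lu lv = go k
      where
      low : ∀ {x y : Cell} → level x ≤ 1 → 2 ≤ level y → x ≢ y
      low l l′ refl = <⇒≱ l′ l
      fst : ∀ {p q : Cell} → level p ≤ 1 → ¬ Same p q u v
      fst l = apart (low l lu) (low l lv)
      snd : ∀ {p q : Cell} → level q ≤ 1 → ¬ Same p q u v
      snd l = [ low l lv ∘ proj₂ , low l lu ∘ proj₂ ]′
      go : ∀ {p q} → Kept p q → ¬ Same p q u v
      go inn      = snd ≤-refl
      go out      = snd ≤-refl
      go rung     = fst z≤n
      go roof     = fst z≤n
      go (down _) = fst z≤n

    ThreeLevels : Set
    ThreeLevels = Cycle CellAdj (Levels 3) (m * 6) (λ p q → Kept p q ⊎ (Side p q ⊎ Up 2 p q))

    three : Cycle (TriAdj g) (Below g m) (m * 6) (Mark g β) → ThreeLevels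
    three C = weaken (mapCycle placeTri C (λ _ _ → placeTri-adj)) to (from _) refl marks
      where
      to : ∀ {w} → (∃ λ v → Below g m v × w ≡ placeTri v) → Levels 3 w
      to (a₀ x δ , lt , refl) = <⇒≤ (double-mono-< lt) , s≤s z≤n , par-even x
      to (a₂ x δ , lt , refl) = <⇒≤ (double-mono-< lt) , ≤-refl , par-even x
      to (b x δ , lt , refl)  = double-mono-< lt , s≤s (s≤s z≤n) , cong not (par-even x)
      from : ∀ w → Levels 3 w → ∃ λ v → Below g m v × w ≡ placeTri v
      from (X , j , δ) (lt , lj , e) with half X
      from (_ , 0 , δ) (lt , lj , e) | even x = a₀ x δ , double-< lt , refl
      from (_ , 1 , δ) (lt , lj , e) | even x = case trans (sym (par-even x)) e of λ ()
      from (_ , 2 , δ) (lt , lj , e) | even x = a₂ x δ , double-< lt , refl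
      from (_ , suc (suc (suc _)) , δ) (lt , s≤s (s≤s (s≤s ())) , e) | even x
      from (_ , 0 , δ) (lt , lj , e) | odd x = case trans (sym (cong not (par-even x))) e of λ ()
      from (_ , 1 , δ) (lt , lj , e) | odd x = b x δ , double-< (<⇒≤ lt) , refl
      from (_ , 2 , δ) (lt , lj , e) | odd x = case trans (sym (cong not (par-even x))) e of λ ()
      from (_ , suc (suc (suc _)) , δ) (lt , s≤s (s≤s (s≤s ())) , e) | odd x
      marks : ∀ {p q} → Kept p q ⊎ (Side p q ⊎ Up 2 p q) → ∃₂ λ u v → Mark g β u v × p ≡ placeTri u × q ≡ placeTri v
      marks (inj₁ inn)      = _ , _ , base inn , refl , refl
      marks (inj₁ out)      = _ , _ , base out , refl , refl
      marks (inj₁ rung)     = _ , _ , rung₀ , refl , refl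
      marks (inj₁ roof)     = _ , _ , roof₀ , refl , refl
      marks (inj₁ (down f)) = _ , _ , down f , refl , refl
      marks (inj₂ (inj₁ (refl , refl))) = _ , _ , base side , refl , refl
      marks (inj₂ (inj₂ (_ , _ , f , refl , refl))) = _ , _ , up f , refl , refl

    Tower : ℕ → Set
    Tower e = Cycle CellAdj (Levels (suc e)) (m * 2 * suc e) (λ p q → Kept p q ⊎ Up e p q)

    -- The two `Up e` edges, one for each bit at β, receive one of the complementary two-level
    -- cycles each. Increasing X and the level by 1 carries them to the `od` rises; the `ev` rises,
    -- two levels up, are the new `Up` edges.
    addDuo : ∀ {e} → 2 ≤ e → par e ≡ false → Tower e → Tower (2 + e)
    addDuo {e} 2≤e pe C = weaken
      (merge cell-sym
        (merge cell-sym C (duo false) (inj₂ (lifted false)) (risen false) near near)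
        (duo true) (inj₁ (inj₂ (lifted true) , apart (λ q → flip-≢ (colour-not β) (cong (proj₂ ∘ proj₂) q)) (β≢ ∘ cong proj₁)))
        (risen true) near near)
      to (from _) (count m e) marks
      where
      count : ∀ m e → m * 2 * suc e + m * 2 + m * 2 ≡ m * 2 * suc (2 + e)
      count = solve-∀
      near : ∀ {X δ} → CellAdj (X , e , δ) (suc X , suc e , δ)
      near {X} = step (inj₁ (+-comm 1 X)) (inj₁ (+-comm 1 e))
      colour-not : ∀ x → Flip (colour true x) (colour false x)
      colour-not x = flip-sym (flip-not _)
      β≢ : β + β ≢ (β + h) + (β + h)
      β≢ = <⇒≢ (+-mono-< (m<m+n β (s≤s z≤n)) (m<m+n β (s≤s z≤n)))
      Placed : Bool → Cell → Set
      Placed δ w = ∃ λ v → Coloured g (colour δ) (colour-flip δ) (colour-const δ) m v × w ≡ placeDuo (suc e) v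
      Risen : Bool → Cell → Cell → Set
      Risen δ p q = ∃₂ λ u v → Rise g (colour δ) (colour-flip δ) (colour-const δ) β u v × p ≡ placeDuo (suc e) u × q ≡ placeDuo (suc e) v
      duo : ∀ δ → Cycle CellAdj (Placed δ) (m * 2) (Risen δ)
      duo δ = mapCycle (placeDuo (suc e)) (twoLevels g (colour δ) (colour-flip δ) (colour-const δ) h≤β) (λ _ _ → placeDuo-adj δ (suc e))
      lifted : ∀ δ → Up e (β + β , e , colour δ β) ((β + h) + (β + h) , e , colour δ (β + h))
      lifted δ = _ , _ , colour-flip δ β , refl , refl
      risen : ∀ δ → Risen δ (suc (β + β) , suc e , colour δ β) (suc ((β + h) + (β + h)) , suc e , colour δ (β + h))
      risen δ = _ , _ , inj₂ (refl , refl) , refl , refl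
      placed : ∀ δ₀ {w} → Placed δ₀ w → Levels (3 + e) w
      placed _ (ev x δ , (lt , _) , refl) = <⇒≤ (double-mono-< lt) , ≤-refl , trans (par-even x) (sym (trans (not-not _) pe))
      placed _ (od x δ , (lt , _) , refl) = double-mono-< lt , n≤1+n _ , cong not (trans (par-even x) (sym pe))
      to : ∀ {w} → (Levels (suc e) w ⊎ Placed false w) ⊎ Placed true w → Levels (3 + e) w
      to (inj₁ (inj₁ (lt , l , p))) = lt , ≤-trans l (≤-trans (n≤1+n _) (n≤1+n _)) , p
      to (inj₁ (inj₂ p)) = placed false p
      to (inj₂ p)        = placed true p
      put : ∀ {w} v → (∀ {δ} → bit v ≡ colour δ (pos v) → Coloured g (colour δ) (colour-flip δ) (colour-const δ) m v) →
        w ≡ placeDuo (suc e) v → (Levels (suc e) w ⊎ Placed false w) ⊎ Placed true w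
      put v f q with colour-total (bit v) (pos v)
      ... | inj₁ c = inj₁ (inj₂ (v , f {false} c , q))
      ... | inj₂ c = inj₂ (v , f {true} c , q)
      from : ∀ w → Levels (3 + e) w → (Levels (suc e) w ⊎ Placed false w) ⊎ Placed true w
      from (X , j , δ) (lt , l , p) with m≤n⇒m<n∨m≡n (s≤s⁻¹ l)
      from (X , j , δ) (lt , l , p) | inj₁ l′ with m≤n⇒m<n∨m≡n (s≤s⁻¹ l′)
      ... | inj₁ l″ = inj₁ (inj₁ (lt , l″ , p))
      ... | inj₂ refl with half X
      ...   | even x = case trans (sym (par-even x)) (trans p (cong not pe)) of λ ()
      ...   | odd x  = put (od x δ) (double-< (<⇒≤ lt) ,_) refl
      from (X , j , δ) (lt , l , p) | inj₂ refl with half X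
      ...   | even x = put (ev x δ) (double-< lt ,_) refl
      ...   | odd x  = case trans (sym (cong not (par-even x))) (trans p (trans (not-not _) pe)) of λ ()
      by-level : ∀ {X X′ Y j j′ δ δ′ ε q} → j ≢ j′ → ¬ Same (X , j , δ) q (X′ , j′ , δ′) (Y , j′ , ε)
      by-level ne = apart (ne ∘ cong level) (ne ∘ cong level)
      marks : ∀ {p q} → Kept p q ⊎ Up (2 + e) p q → _
      marks (inj₁ k) = inj₁ (inj₁ (inj₁ k , kept-low k 2≤e 2≤e) , kept-low k 2≤e 2≤e)
      marks (inj₂ (δ , δ′ , f , refl , refl)) with colour-total δ β
      ... | inj₁ refl rewrite flip-det f (colour-flip false β) =
        inj₁ (inj₂ ((_ , _ , inj₁ (refl , refl) , refl , refl) , by-level (1+n≢n)) , by-level (λ q → 1+n≰n (≤-trans (n≤1+n _) (≤-reflexive q))))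
      ... | inj₂ refl rewrite flip-det f (colour-flip true β) =
        inj₂ ((_ , _ , inj₁ (refl , refl) , refl , refl) , by-level 1+n≢n)

    tower : ThreeLevels → ∀ t → Tower (2 + (t + t))
    tower C zero    = weaken C id id (sym (*-assoc m 2 3)) [ inj₁ , inj₂ ∘ inj₂ ]′
    tower C (suc t) = subst Tower (cong (λ z → 3 + z) (sym (+-suc t t))) (addDuo (m≤m+n 2 _) (trans (not-not _) (par-even t)) (tower C t))

    mirror : ℕ → ℕ
    mirror X = (β + h) + m ∸ X

    mirror-odd : par ((β + h) + m) ≡ true
    mirror-odd = trans (cong par (+-suc (β + h) (β + h))) (cong not (par-even (β + h)))

    mirror-top : mirror ((β + h) + (β + h)) ≡ 1
    mirror-top = trans (cong (_∸ ((β + h) + (β + h))) (trans (+-suc (β + h) (β + h)) (+-comm 1 ((β + h) + (β + h))))) (m+n∸m≡n ((β + h) + (β + h)) 1)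

    mirror-β : mirror (β + β) ≡ suc (h + h)
    mirror-β = trans (cong (_∸ (β + β)) (arith β h)) (m+n∸m≡n (β + β) (suc (h + h)))
      where
      arith : ∀ β h → (β + h) + suc (β + h) ≡ (β + β) + suc (h + h)
      arith = solve-∀

    -- Both going up three levels and reflecting X exchange the two parity classes, so a reflected odd
    -- tower fits on top of three levels.
    doubleTower : ThreeLevels → ∀ t → Cycle CellAdj (Levels (6 + (t + t))) (m * 2 * (6 + (t + t))) Kept
    doubleTower C t = weaken
      (merge cell-sym C (mapCycle f (symmetrise (tower C t)) adj)
        -- `Side` lies at X = 0 and 2h on level 2. The mirror image of `down`, read backwards, lies
        -- at X = 1 and 2h + 1 on level 3 with the same bits.
        (inj₂ (inj₁ (refl , refl))) (_ , _ , inj₂ (inj₁ (down tf)) , refl , refl)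
        (step (inj₁ mirror-top) (inj₁ refl)) (step (inj₁ (trans mirror-β (+-comm 1 (h + h)))) (inj₁ refl)))
      to (from _) (count m t)
      (λ k → inj₁ (inj₁ k , kept-low k ≤-refl ≤-refl))
      where
      count : ∀ m t → m * 6 + m * 2 * suc (2 + (t + t)) ≡ m * 2 * (6 + (t + t))
      count = solve-∀
      f : Cell → Cell
      f (X , j , δ) = mirror X , 3 + j , δ
      adj : ∀ {p q} → Levels (suc (2 + (t + t))) p → Levels (suc (2 + (t + t))) q → CellAdj p q → CellAdj (f p) (f q)
      adj (l , _) (l′ , _) (step d e) = step (reflect (s≤s⁻¹ l) (s≤s⁻¹ l′) d) ([ inj₁ ∘ cong (3 +_) , inj₂ ∘ cong (3 +_) ]′ e)
      adj (l , _) (l′ , _) (leap d φ) = leap (reflect (s≤s⁻¹ l) (s≤s⁻¹ l′) d) φ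
      to : ∀ {w} → Levels 3 w ⊎ (∃ λ v → Levels (suc (2 + (t + t))) v × w ≡ f v) → Levels (6 + (t + t)) w
      to (inj₁ (l , l′ , p)) = l , ≤-trans l′ (m≤m+n 3 _) , p
      to (inj₂ ((X , j , δ) , (l , l′ , p) , refl)) =
        s≤s (m∸n≤m _ X) , +-monoʳ-≤ 3 l′ , trans (par-reflect (s≤s⁻¹ l) mirror-odd) (trans (cong not p) (sym (not-not _)))
      from : ∀ w → Levels (6 + (t + t)) w → Levels 3 w ⊎ (∃ λ v → Levels (suc (2 + (t + t))) v × w ≡ f v)
      from (X , 0 , δ) (l , l′ , p) = inj₁ (l , s≤s z≤n , p)
      from (X , 1 , δ) (l , l′ , p) = inj₁ (l , s≤s (s≤s z≤n) , p)
      from (X , 2 , δ) (l , l′ , p) = inj₁ (l , ≤-refl , p)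
      from (X , suc (suc (suc j)) , δ) (l , s≤s (s≤s (s≤s l′)) , p) = inj₂ ((mirror X , j , δ)
        , (s≤s (m∸n≤m _ X) , l′ , trans (par-reflect (s≤s⁻¹ l) mirror-odd) (trans (cong not p) (trans (not-not _) (not-not _))))
        , cong (λ z → z , suc (suc (suc j)) , δ) (sym (m∸[m∸n]≡n (s≤s⁻¹ l))))

    -- Adding bands of two levels to one band of three gives the odd heights; an even height takes
    -- two bands of three, hence the bound 6.
    stack : ThreeLevels → ∀ l → 6 ≤ l → Cycle CellAdj (Levels l) (m * 2 * l) Kept
    stack C l 6≤l with half l
    ... | odd (suc t) = subst (λ z → Cycle CellAdj (Levels z) (m * 2 * z) Kept) (cong (2 +_) (sym (+-suc t t))) (weaken (tower C t) id id refl inj₁)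
    ... | even (suc (suc (suc t))) = subst (λ z → Cycle CellAdj (Levels z) (m * 2 * z) Kept) (arith t) (doubleTower C t)
      where
      arith : ∀ t → 6 + (t + t) ≡ (3 + t) + (3 + t)
      arith = solve-∀
    stack C _ (s≤s ()) | odd zero
    stack C _ () | even zero
    stack C _ (s≤s (s≤s ())) | even (suc zero)
    stack C _ (s≤s (s≤s (s≤s (s≤s ())))) | even (suc (suc zero))

-- The square board

sumTo-* : ∀ c f k → sumTo (λ i → c * f i) k ≡ c * sumTo f k
sumTo-* c f zero    = refl
sumTo-* c f (suc k) = trans (cong (_+ c * f (suc k)) (sumTo-* c f k)) (sym (*-distribˡ-+ c (sumTo f k) (f (suc k))))

sumTo-+ : ∀ c f k → sumTo (λ i → c + f i) k ≡ suc k * c + sumTo f k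
sumTo-+ c f zero    = cong (_+ f 0) (sym (+-identityʳ c))
sumTo-+ c f (suc k) = trans (cong (_+ (c + f (suc k))) (sumTo-+ c f k)) (arith (suc k * c) c (sumTo f k) (f (suc k)))
  where
  arith : ∀ a c s t → (a + s) + (c + t) ≡ (c + a) + (s + t)
  arith = solve-∀

extra : ℕ → ℕ → ℕ
extra r ρ with ρ <? r
... | yes _ = 1
... | no _  = 0

sumTo-extra : ∀ r k → sumTo (extra r) k ≡ suc k ⊓ r
sumTo-extra zero    zero = refl
sumTo-extra (suc r) zero = refl
sumTo-extra r (suc k) with suc k <? r
... | yes lt = trans (cong (_+ 1) (trans (sumTo-extra r k) (m≤n⇒m⊓n≡m (<⇒≤ lt)))) (trans (+-comm (suc k) 1) (sym (m≤n⇒m⊓n≡m lt)))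
... | no ge  = trans (+-identityʳ _) (trans (sumTo-extra r k) (trans (m≥n⇒m⊓n≡n (≮⇒≥ ge)) (sym (m≥n⇒m⊓n≡n (m≤n⇒m≤1+n (≮⇒≥ ge))))))

put : ℕ → Bool → ℕ
put z false = z + z
put z true  = suc (z + z)

half-put : ∀ z δ → ⌊ put z δ /2⌋ ≡ z
half-put z false = sym (n≡⌊n+n/2⌋ z)
half-put z true  = sym (n≡⌈n+n/2⌉ z)

par-put : ∀ z δ → par (put z δ) ≡ δ
par-put z false = par-even z
par-put z true  = cong not (par-even z)

put-+ : ∀ z k δ → put (z + k) δ ≡ put z δ + (k + k)
put-+ z k false = arith z k
  where
  arith : ∀ z k → (z + k) + (z + k) ≡ (z + z) + (k + k)
  arith = solve-∀
put-+ z k true = cong suc (put-+ z k false)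

put-flip : ∀ z {δ δ′} → Flip δ δ′ → Dist 1 (put z δ) (put z δ′)
put-flip z ft = inj₁ (+-comm 1 (z + z))
put-flip z tf = inj₂ (+-comm 1 (z + z))

put-next : ∀ z → Dist 1 (put z true) (put (suc z) false)
put-next z = inj₁ (trans (cong suc (+-suc z z)) (+-comm 1 (suc (z + z))))

put-< : ∀ {z m} δ → z < m → put z δ < m + m
put-< false l = <⇒≤ (double-mono-< l)
put-< true  l = double-mono-< l

unput : ∀ y → ∃₂ λ z δ → y ≡ put z δ
unput y with half y
... | even z = z , false , refl
... | odd z  = z , true , refl

put-bound : ∀ {z m} δ → put z δ < m + m → z < m
put-bound false l = double-< l
put-bound true  l = double-< (<⇒≤ l)

-- Moves on the square board, and its division into columns of levels

Square : Set
Square = ℕ × ℕ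

module _ (g : ℕ) where

  private
    h : ℕ
    h = suc g

  data SquareAdj : Square → Square → Set where
    flat  : ∀ {x x′ y y′} → Dist (h + h) x x′ → Dist 1 y y′ → SquareAdj (x , y) (x′ , y′)
    steep : ∀ {x x′ y y′} → Dist 1 x x′ → Dist (h + h) y y′ → SquareAdj (x , y) (x′ , y′)

  square-sym : ∀ {p q} → SquareAdj p q → SquareAdj q p
  square-sym (flat d e)  = flat (dist-sym d) (dist-sym e)
  square-sym (steep d e) = steep (dist-sym d) (dist-sym e)

  module _ (β : ℕ) (h≤β : h ≤ β) where

    private
      m n : ℕ
      m = suc (β + h)
      n = m + m

    -- The number of j with ρ + j h < m: the first m mod h classes have one level more than the
    -- others.
    rows : ℕ → ℕ
    rows ρ = m / h + extra (m % h) ρ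

    m-split : m ≡ m % h + m / h * h
    m-split = m≡m%n+[m/n]*n m h

    rows-to : ∀ {ρ j} → ρ < h → j < rows ρ → ρ + j * h < m
    rows-to {ρ} {j} ρ<h l with ρ <? m % h
    ... | yes lt = subst (ρ + j * h <_) (sym m-split) (+-mono-<-≤ lt (*-monoˡ-≤ h (s≤s⁻¹ (subst (j <_) (+-comm (m / h) 1) l))))
    ... | no ge  = subst (ρ + j * h <_) (sym m-split) (<-≤-trans (+-monoˡ-< (j * h) ρ<h)
      (≤-trans (*-monoˡ-≤ h (subst (j <_) (+-identityʳ (m / h)) l)) (m≤n+m _ (m % h))))

    rows-from : ∀ {ρ j} → ρ + j * h < m → j < rows ρ
    rows-from {ρ} {j} l = ≰⇒> bad
      where
      bad : ¬ (rows ρ ≤ j)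
      bad le with ρ <? m % h
      ... | yes lt = <⇒≱ l (subst (_≤ ρ + j * h) (sym m-split) (≤-trans (<⇒≤ (+-monoˡ-< (m / h * h) (m%n<n m h)))
        (≤-trans (*-monoˡ-≤ h (subst (_≤ j) (+-comm (m / h) 1) le)) (m≤n+m _ ρ))))
      ... | no ge = <⇒≱ l (subst (_≤ ρ + j * h) (sym m-split) (+-mono-≤ (≮⇒≥ ge) (*-monoˡ-≤ h (subst (_≤ j) (+-identityʳ (m / h)) le))))

    rows-sum : sumTo rows g ≡ m
    rows-sum = trans (sumTo-+ (m / h) (extra (m % h)) g) (trans (cong (h * (m / h) +_) (trans (sumTo-extra (m % h) g) (m≥n⇒m⊓n≡n (<⇒≤ (m%n<n m h)))))
      (trans (+-comm (h * (m / h)) (m % h)) (trans (cong (m % h +_) (*-comm h (m / h))) (sym m-split))))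

    -- The Boolean selects the parity class: both are images of `Levels`, the second one through the
    -- reflection.
    μ : Bool → ℕ → ℕ
    μ false X = X
    μ true  X = mirror g β h≤β X

    μ-dist : ∀ ε {k X X′} → X < n → X′ < n → Dist k X X′ → Dist k (μ ε X) (μ ε X′)
    μ-dist false _ _ d = d
    μ-dist true  l l′ d = reflect (s≤s⁻¹ l) (s≤s⁻¹ l′) d

    μ-< : ∀ ε {X} → X < n → μ ε X < n
    μ-< false l = l
    μ-< true {X} l = s≤s (m∸n≤m _ X)

    column : Bool → ℕ → Cell → Square
    column ε ρ (X , j , δ) = μ ε X , put (ρ + j * h) δ

    column-level : ∀ ε ρ (s t : Cell) → column ε ρ s ≡ column ε ρ t → level s ≡ level t
    column-level ε ρ (_ , j , δ) (_ , j′ , δ′) e = *-cancelʳ-≡ j j′ h (+-cancelˡ-≡ ρ _ _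
      (trans (sym (half-put (ρ + j * h) δ)) (trans (cong (⌊_/2⌋ ∘ proj₂) e) (half-put (ρ + j′ * h) δ′))))

    column-bit : ∀ ε ε′ ρ ρ′ (s t : Cell) → column ε ρ s ≡ column ε′ ρ′ t → proj₂ (proj₂ s) ≡ proj₂ (proj₂ t)
    column-bit _ _ ρ ρ′ (_ , j , δ) (_ , j′ , δ′) e =
      trans (sym (par-put (ρ + j * h) δ)) (trans (cong (par ∘ proj₂) e) (par-put (ρ′ + j′ * h) δ′))

    by-level : ∀ ε ρ (s t t′ : Cell) {q} → level s ≢ level t → level s ≢ level t′ →
      ¬ Same (column ε ρ s) q (column ε ρ t) (column ε ρ t′)
    by-level ε ρ s t t′ n n′ = apart (n ∘ column-level ε ρ s t) (n′ ∘ column-level ε ρ s t′)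

    by-bit : ∀ ε ε′ ρ ρ′ (s t t′ : Cell) {q} → proj₂ (proj₂ s) ≢ proj₂ (proj₂ t) → proj₂ (proj₂ s) ≢ proj₂ (proj₂ t′) →
      ¬ Same (column ε ρ s) q (column ε′ ρ′ t) (column ε′ ρ′ t′)
    by-bit ε ε′ ρ ρ′ s t t′ n n′ = apart (n ∘ column-bit ε ε′ ρ ρ′ s t) (n′ ∘ column-bit ε ε′ ρ ρ′ s t′)

    row-next : ∀ ρ j δ → put (ρ + (j + 1) * h) δ ≡ put (ρ + j * h) δ + (h + h)
    row-next ρ j δ = trans (cong (λ z → put z δ) (arith ρ j h)) (put-+ (ρ + j * h) h δ)
      where
      arith : ∀ ρ j h → ρ + (j + 1) * h ≡ ρ + j * h + h
      arith = solve-∀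

    column-adj : ∀ ε ρ {l p q} → Levels g β h≤β l p → Levels g β h≤β l q → CellAdj g p q → SquareAdj (column ε ρ p) (column ε ρ q)
    column-adj ε ρ (l , _) (l′ , _) (step {j = j} {δ = δ} d (inj₁ refl)) = steep (μ-dist ε l l′ d) (inj₁ (row-next ρ j δ))
    column-adj ε ρ (l , _) (l′ , _) (step {j′ = j} {δ} d (inj₂ refl)) = steep (μ-dist ε l l′ d) (inj₂ (row-next ρ j δ))
    column-adj ε ρ (l , _) (l′ , _) (leap {j = j} d f) = flat (μ-dist ε l l′ d) (put-flip (ρ + j * h) f)

    module _ (three : ThreeLevels g β h≤β) (6≤ : ∀ ρ → 6 ≤ rows ρ) where

      Column : Bool → ℕ → Square → Set
      Column ε ρ w = ρ < h × ∃ λ v → Levels g β h≤β (rows ρ) v × w ≡ column ε ρ v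

      ColumnEdge : Bool → ℕ → Square → Square → Set
      ColumnEdge ε ρ p q = ∃₂ λ u v → Kept g β h≤β u v × p ≡ column ε ρ u × q ≡ column ε ρ v

      columnCycle : ∀ ε {ρ} → ρ ≤ g → Cycle SquareAdj (Column ε ρ) (m * 2 * rows ρ) (ColumnEdge ε ρ)
      columnCycle ε {ρ} le = weaken (mapCycle (column ε ρ) (stack g β h≤β three (rows ρ) (6≤ ρ)) (λ p q → column-adj ε ρ p q))
        (s≤s le ,_) proj₂ refl id

      -- Reads ρ off the row, since z = ρ + j h; this gives the disjointness that `chain` asks for.
      key : Square → ℕ
      key (_ , y) = ⌊ y /2⌋ % h

      column-key : ∀ ε {ρ w} → Column ε ρ w → key w ≡ ρ
      column-key ε {ρ} (l , (X , j , δ) , _ , refl) = trans (cong (_% h) (half-put (ρ + j * h) δ)) (trans ([m+kn]%n≡m%n ρ j h) (m<n⇒m%n≡m l))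

      -- The first class of the chain has no predecessor, so its `inn` stays free to join the two
      -- halves of the board.
      data Free (ε : Bool) (ρ : ℕ) : Square → Square → Set where
        rung : ∀ {δ} → Free ε ρ (column ε ρ (β + β , 0 , δ)) (column ε ρ (suc (β + β) , 1 , δ))
        roof : ∀ {δ} → Free ε ρ (column ε ρ ((β + h) + (β + h) , 0 , δ)) (column ε ρ (suc ((β + h) + (β + h)) , 1 , δ))
        inn  : ρ ≡ 0 → Free ε ρ (column ε ρ (0 , 2 , false)) (column ε ρ (1 , 1 , false))

      1<n : 1 < n
      1<n = s≤s (≤-trans (s≤s z≤n) (m≤n+m m (β + h)))

      2h<n : suc (h + h) < n
      2h<n = double-mono-< (s≤s (m≤n+m h β))

      o₁ o₂ i₁ i₂ : Cell
      o₁ = h + h , 2 , true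
      o₂ = suc (h + h) , 1 , true
      i₁ = 0 , 2 , false
      i₂ = 1 , 1 , false

      -- Row 2z + 1 of class ρ lies next to row 2(z + 1) of class ρ + 1 on the same level. Hence
      -- `out`, with bit true at X = 2h and 2h + 1, meets `inn`, with bit false at X = 0 and 1, by
      -- moves of 2h in X and 1 in the row.
      halfBoard : ∀ ε → Cycle SquareAdj (λ w → ∃ λ ρ → ρ ≤ g × Column ε ρ w) (sumTo (λ ρ → m * 2 * rows ρ) g) (λ p q → ∃ λ ρ → ρ ≤ g × Free ε ρ p q)
      halfBoard ε = chain square-sym {R = ColumnEdge ε} {F = Free ε}
        {u = λ ρ → column ε ρ o₁} {v = λ ρ → column ε ρ o₂} {u′ = λ ρ → column ε ρ i₁} {v′ = λ ρ → column ε ρ i₂} g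
        (λ p q → trans (sym (column-key ε p)) (column-key ε q)) (columnCycle ε)
        (_ , _ , out , refl , refl) (_ , _ , inn , refl , refl)
        (λ {ρ} → by-bit ε ε ρ ρ o₁ i₁ i₂ (λ ()) λ ())
        (λ {ρ} _ → flat (dist-sym (μ-dist ε (s≤s z≤n) (<⇒≤ 2h<n) (inj₁ refl))) (put-next (ρ + 2 * h)))
        (λ {ρ} _ → flat (dist-sym (μ-dist ε 1<n 2h<n (inj₁ refl))) (put-next (ρ + 1 * h)))
        (λ { (rung {δ}) → _ , _ , rung {δ = δ} , refl , refl ; (roof {δ}) → _ , _ , roof {δ = δ} , refl , refl ; (inn _) → _ , _ , inn , refl , refl })
        (λ { {ρ} (rung {δ}) → by-level ε ρ (β + β , 0 , δ) o₁ o₂ (λ ()) λ ()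
           ; {ρ} (roof {δ}) → by-level ε ρ ((β + h) + (β + h) , 0 , δ) o₁ o₂ (λ ()) λ ()
           ; {ρ} (inn _) → by-bit ε ε ρ ρ i₁ o₁ o₂ (λ ()) λ () })
        (λ { {ρ} (rung {δ}) → by-level ε (suc ρ) (β + β , 0 , δ) i₁ i₂ (λ ()) λ ()
           ; {ρ} (roof {δ}) → by-level ε (suc ρ) ((β + h) + (β + h) , 0 , δ) i₁ i₂ (λ ()) λ () })

      -- One pair of edges for each half of the board; within a pair the two edges differ by a
      -- translation by a = 2h along x.
      Displaced : Square → Square → Set
      Displaced p q = ∃ λ ε → (p ≡ (μ ε (β + β) , 0) × q ≡ (μ ε (suc (β + β)) , h + h))
        ⊎ (p ≡ (μ ε ((β + h) + (β + h)) , 0) × q ≡ (μ ε (suc ((β + h) + (β + h))) , h + h))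

      -- Above class g on level j comes class 0 on level j + 1. The connecting move keeps the parity
      -- of X while j grows by 1, so it passes from one half of the board to the other.
      board : Cycle SquareAdj (λ { (x , y) → x < n × y < n }) (n * n) Displaced
      board = weaken
        (merge square-sym (halfBoard false) (symmetrise (halfBoard true))
          {column false g (β + β , 0 , true)} {column false g (suc (β + β) , 1 , true)}
          {column true 0 i₂} {column true 0 i₁}
          (g , ≤-refl , rung {δ = true}) (inj₂ (0 , z≤n , inn refl))
          (flat (inj₁ (trans mirror₁ (double-h g β))) (put-next (g + 0)))
          (flat (inj₁ (trans mirror₀ (cong suc (double-h g β)))) (put-next (g + 1 * h))))
        to (from _) total marks
        where
        mirror₁ : mirror g β h≤β 1 ≡ (β + h) + (β + h)
        mirror₁ = cong (_∸ 1) (+-suc (β + h) (β + h))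
        mirror₀ : mirror g β h≤β 0 ≡ suc ((β + h) + (β + h))
        mirror₀ = +-suc (β + h) (β + h)
        sum : sumTo (λ ρ → m * 2 * rows ρ) g ≡ m * 2 * m
        sum = trans (sumTo-* (m * 2) rows g) (cong (m * 2 *_) rows-sum)
        total : sumTo (λ ρ → m * 2 * rows ρ) g + sumTo (λ ρ → m * 2 * rows ρ) g ≡ n * n
        total = trans (cong₂ _+_ sum sum) (arith m)
          where
          arith : ∀ m → m * 2 * m + m * 2 * m ≡ (m + m) * (m + m)
          arith = solve-∀
        Half-board : Bool → Square → Set
        Half-board ε w = ∃ λ ρ → ρ ≤ g × Column ε ρ w
        inside : ∀ ε {x y} → Half-board ε (x , y) → x < n × y < n
        inside ε (ρ , le , l , (X , j , δ) , (lX , lj , _) , refl) = μ-< ε lX , put-< δ (rows-to l lj)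
        to : ∀ {w} → Half-board false w ⊎ Half-board true w → proj₁ w < n × proj₂ w < n
        to (inj₁ p) = inside false p
        to (inj₂ p) = inside true p
        from : ∀ w → proj₁ w < n × proj₂ w < n → Half-board false w ⊎ Half-board true w
        from (x , y) (lx , ly) with unput y
        ... | z , δ , refl with bool-≡ (par x) (par (z / h))
          where
          bool-≡ : ∀ δ ε → δ ≡ ε ⊎ not δ ≡ ε
          bool-≡ false false = inj₁ refl
          bool-≡ false true  = inj₂ refl
          bool-≡ true  false = inj₂ refl
          bool-≡ true  true  = inj₁ refl
        ... | inj₁ e = inj₁ (z % h , s≤s⁻¹ (m%n<n z h) , m%n<n z h , (x , z / h , δ) , (lx , lj , e) , cong (λ k → x , put k δ) (m≡m%n+[m/n]*n z h))
          where
          lj : z / h < rows (z % h)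
          lj = rows-from (subst (_< m) (m≡m%n+[m/n]*n z h) (put-bound δ ly))
        ... | inj₂ e = inj₂ (z % h , s≤s⁻¹ (m%n<n z h) , m%n<n z h , (μ true x , z / h , δ)
            , (μ-< true lx , lj , trans (par-reflect (s≤s⁻¹ lx) (mirror-odd g β h≤β)) e)
            , cong₂ (λ k k′ → k , put k′ δ) (sym (m∸[m∸n]≡n (s≤s⁻¹ lx))) (m≡m%n+[m/n]*n z h))
          where
          lj : z / h < rows (z % h)
          lj = rows-from (subst (_< m) (m≡m%n+[m/n]*n z h) (put-bound δ ly))
        away : ∀ X {q} → ¬ Same (column false 0 (X , 0 , false)) q (column false g (β + β , 0 , true)) (column false g (suc (β + β) , 1 , true))
        away X = by-bit false false 0 g (X , 0 , false) (β + β , 0 , true) (suc (β + β) , 1 , true) (λ ()) λ ()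
        away′ : ∀ X {q} → ¬ Same (column true 0 (X , 0 , false)) q (column true 0 i₂) (column true 0 i₁)
        away′ X = by-level true 0 (X , 0 , false) i₂ i₁ (λ ()) λ ()
        h≡ : (0 + 1 * h) + (0 + 1 * h) ≡ h + h
        h≡ = cong₂ _+_ (+-identityʳ h) (+-identityʳ h)
        free : ∀ ε {p q p′ q′} → Free ε 0 p q → p ≡ p′ → q ≡ q′ → Free ε 0 p′ q′
        free ε f refl refl = f
        marks : ∀ {p q} → Displaced p q → _
        marks (false , inj₁ (refl , refl)) = inj₁ ((0 , z≤n , free false (rung {δ = false}) refl (cong (suc (β + β) ,_) h≡)) , away (β + β))
        marks (false , inj₂ (refl , refl)) = inj₁ ((0 , z≤n , free false (roof {δ = false}) refl (cong (suc ((β + h) + (β + h)) ,_) h≡)) , away ((β + h) + (β + h)))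
        marks (true , inj₁ (refl , refl)) = inj₂ (inj₁ (0 , z≤n , free true (rung {δ = false}) refl (cong (μ true (suc (β + β)) ,_) h≡)) , away′ (β + β))
        marks (true , inj₂ (refl , refl)) = inj₂ (inj₁ (0 , z≤n , free true (roof {δ = false}) refl (cong (μ true (suc ((β + h) + (β + h))) ,_) h≡)) , away′ ((β + h) + (β + h)))

-- Tours

dist-∣-∣ : ∀ {k x y} → Dist k x y → ∣ x - y ∣ ≡ k
dist-∣-∣ {k} {x} (inj₁ refl) = ∣m-m+n∣≡n x k
dist-∣-∣ {k} {y = y} (inj₂ refl) = trans (∣-∣-comm (y + k) y) (∣m-m+n∣≡n y k)

knight-sym : ∀ {a c n d} {x y : Vertex n d} → KnightAdj a c n d x y → KnightAdj a c n d y x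
knight-sym {x = x} {y} (i , j , i≢j , p , q , r) =
  i , j , i≢j , trans (∣-∣-comm (toℕ (lookupV y i)) _) p , trans (∣-∣-comm (toℕ (lookupV y j)) _) q , λ k k≢i k≢j → sym (r k k≢i k≢j)

steps-lookup : ∀ {V : Set} (x : V) l (i j : Fin (suc (length l))) → toℕ j ≡ suc (toℕ i) →
  Steps x l (lookup (x ∷ l) i) (lookup (x ∷ l) j)
steps-lookup x (y ∷ l) zero    (suc zero)    e = first
steps-lookup x (y ∷ l) (suc i) (suc j)       e = later (steps-lookup y l i j (suc-injective e))

lookup-last : ∀ {V : Set} (x : V) l (i : Fin (suc (length l))) → toℕ i ≡ length l → lookup (x ∷ l) i ≡ last x l
lookup-last x []      zero    e = refl
lookup-last x (y ∷ l) (suc i) e = lookup-last y l i (suc-injective e)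

-- If k were missed, punching it out would embed `Fin (suc N)` into `Fin N`.
endo-surjective : ∀ {N} (f : Fin N → Fin N) → (∀ {i j} → f i ≡ f j → i ≡ j) → ∀ k → ∃ λ i → f i ≡ k
endo-surjective {suc N} f inj k with any? (λ i → f i ≟F k)
... | yes p = p
... | no p  = ⊥-elim (<-irrefl refl (injective⇒≤ {f = λ i → punchOut (λ e → p (i , sym e))}
  (λ {i} {j} e → inj (punchOut-injective (λ e → p (i , sym e)) (λ e → p (j , sym e)) e))))

-- `from` finds a place of each vertex in the list and has `to` as left inverse. Composed with the
-- enumeration `list` of the vertices, it is an injective self-map of `Fin (n ^ d)`, hence
-- surjective, and this makes `to` injective: no vertex is repeated.
cycle⇒tour : ∀ {a c n d R} → Cycle (KnightAdj a c n d) (λ _ → ⊤) (n ^ d) R → KnightTour a c n d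
cycle⇒tour {a} {c} {n} {d} C = record
  { to = to ; cong = cong to
  ; bijective = injective , λ y → from y , λ { refl → to-from y } } , adj
  where
  open Cycle C
  vs = start ∷ rest
  to : Fin (n ^ d) → Vertex n d
  to i = lookup vs (castFin (sym size) i)
  from : Vertex n d → Fin (n ^ d)
  from v = castFin size (any-index (complete {v} tt))
  to-from : ∀ v → to (from v) ≡ v
  to-from v = trans (cong (lookup vs) (trans (cast-trans size (sym size) (any-index (complete {v} tt))) (cast-is-id refl (any-index (complete {v} tt)))))
    (sym (lookup-index (complete {v} tt)))
  list : Fin (n ^ d) → Vertex n d
  list k = tabulate (finToFun {n} {d} k)
  list-injective : ∀ {i j} → list i ≡ list j → i ≡ j
  list-injective {i} {j} e = trans (sym (funToFin-finToFin {d} {n} i)) (trans (fun-cong d agree) (funToFin-finToFin {d} {n} j))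
    where
    agree : ∀ k → finToFun {n} {d} i k ≡ finToFun {n} {d} j k
    agree k = trans (sym (lookup∘tabulate (finToFun {n} {d} i) k)) (trans (cong (λ v → lookupV v k) e) (lookup∘tabulate (finToFun {n} {d} j) k))
    fun-cong : ∀ d {f f′ : Fin d → Fin n} → (∀ k → f k ≡ f′ k) → funToFin f ≡ funToFin f′
    fun-cong zero    e = refl
    fun-cong (suc d) e = cong₂ combine (e zero) (fun-cong d (e ∘ suc))
  from-list : ∀ k → ∃ λ i → from (list i) ≡ k
  from-list = endo-surjective (from ∘ list) λ {i} {j} e → list-injective (trans (sym (to-from (list i))) (trans (cong to e) (to-from (list j))))
  injective : ∀ {i j} → to i ≡ to j → i ≡ j
  injective {i} {j} e with from-list i | from-list j
  ... | k , refl | k′ , refl = cong from (trans (sym (to-from (list k))) (trans e (to-from (list k′))))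
  adj : ∀ i j → CycSucc (n ^ d) i j → KnightAdj a c n d (to i) (to j)
  adj i j (inj₁ e) = adjacent (steps-weaken _ (steps-lookup start rest _ _
    (trans (toℕ-cast _ j) (trans e (cong suc (sym (toℕ-cast _ i)))))))
  adj i j (inj₂ (e , e′)) = adjacent (subst₂ (Loop start rest)
    (sym (lookup-last start rest _ (trans (toℕ-cast _ i) (trans e (cong (_∸ 1) (sym size)))))) (sym at-start) (steps-last rest))
    where
    at-start : to j ≡ start
    at-start = cong (lookup vs) (toℕ-injective {j = zero} (trans (toℕ-cast _ j) e′))

-- Raising the dimension

module _ (a n′ : ℕ) where

  private
    n : ℕ
    -- `raise` takes its new pairs from the layers 0 and 1, so both must exist.
    n = suc (suc n′)

  -- Reduction modulo n makes the map total; it is meant for k < n, where the value is k.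
  fin : ℕ → Fin n
  fin k = k mod n

  toℕ-fin : ∀ {k} → k < n → toℕ (fin k) ≡ k
  toℕ-fin {k} l = trans (toℕ-fromℕ< (m%n<n k n)) (m<n⇒m%n≡m l)

  fin-toℕ : ∀ i → fin (toℕ i) ≡ i
  fin-toℕ i = toℕ-injective (toℕ-fin (toℕ<n i))

  Shifted : ∀ {d} → Vertex n d → Vertex n d → Set
  Shifted u v = ∃ λ i → ∣ toℕ (lookupV u i) - toℕ (lookupV v i) ∣ ≡ a × (∀ k → k ≢ i → lookupV u k ≡ lookupV v k)

  shifted-∷ : ∀ {d} (i : Fin n) {u v : Vertex n d} → Shifted u v → Shifted (i ∷ u) (i ∷ v)
  shifted-∷ i (j , e , r) = suc j , e , λ { zero _ → refl ; (suc k) ne → r k (ne ∘ cong suc) }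

  knight-∷ : ∀ {d} (i : Fin n) {u v : Vertex n d} → KnightAdj a 1 n d u v → KnightAdj a 1 n (suc d) (i ∷ u) (i ∷ v)
  knight-∷ i (j , k , ne , p , q , r) = suc j , suc k , (λ { refl → ne refl }) , p , q ,
    λ { zero _ _ → refl ; (suc l) ne′ ne″ → r l (ne′ ∘ cong suc) (ne″ ∘ cong suc) }

  knight-up : ∀ {d k} {u v : Vertex n d} → suc k < n → Shifted u v → KnightAdj a 1 n (suc d) (fin k ∷ u) (fin (suc k) ∷ v)
  knight-up {k = k} l (j , e , r) = suc j , zero , (λ ()) , e ,
    subst₂ (λ x y → ∣ x - y ∣ ≡ 1) (sym (toℕ-fin (<⇒≤ l))) (sym (toℕ-fin l)) (dist-∣-∣ {1} {k} (inj₁ (+-comm 1 k))) ,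
    λ { zero _ ne → ⊥-elim (ne refl) ; (suc i) ne _ → r i (ne ∘ cong suc) }

  data OneOf {V : Set} (u v x y : V) : V → V → Set where
    one : OneOf u v x y u v
    two : OneOf u v x y x y

  -- The pair `u v`, `u′ v′` is spent on linking layers, while `x y`, `x′ y′` survives in every
  -- layer.
  record Liftable (d : ℕ) : Set where
    field
      {u v u′ v′ x y x′ y′} : Vertex n d
      uu : Shifted u u′
      vv : Shifted v v′
      xx : Shifted x x′
      yy : Shifted y y′
      u≢u′ : ¬ Same u v u′ v′
      x≢x′ : ¬ Same x y x′ y′
      free : ∀ {p q} → OneOf x y x′ y′ p q → ¬ Same p q u v
      free′ : ∀ {p q} → OneOf x y x′ y′ p q → ¬ Same p q u′ v′
      cycle : Cycle (KnightAdj a 1 n d) (λ _ → ⊤) (n ^ d) (λ p q → OneOf u v u′ v′ p q ⊎ OneOf x y x′ y′ p q)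

  same-∷ : ∀ {d} (i : Fin n) {p q r s : Vertex n d} → ¬ Same p q r s → ¬ Same (i ∷ p) (i ∷ q) (i ∷ r) (i ∷ s)
  same-∷ i ne (inj₁ (refl , refl)) = ne (inj₁ (refl , refl))
  same-∷ i ne (inj₂ (refl , refl)) = ne (inj₂ (refl , refl))

  sumTo-const : ∀ c k → sumTo (λ _ → c) k ≡ suc k * c
  sumTo-const c zero    = sym (+-identityʳ c)
  sumTo-const c (suc k) = trans (cong (_+ c) (sumTo-const c k)) (+-comm (suc k * c) c)

  -- From `u v` in layer k to `u′ v′` in layer k + 1 the new coordinate changes by 1 and an old one
  -- by a. The surviving pair, taken in layer 0 and again in layer 1, yields the two pairs of the
  -- new tour.
  raise : ∀ {d} → Liftable d → Liftable (suc d)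
  raise {d} L = record
    { uu = shifted-∷ (fin 0) xx ; vv = shifted-∷ (fin 0) yy ; xx = shifted-∷ (fin 1) xx ; yy = shifted-∷ (fin 1) yy
    ; u≢u′ = same-∷ (fin 0) x≢x′ ; x≢x′ = same-∷ (fin 1) x≢x′
    ; free = λ { one → apart (λ ()) λ () ; two → apart (λ ()) λ () }
    ; free′ = λ { one → apart (λ ()) λ () ; two → apart (λ ()) λ () }
    ; cycle = weaken layers (λ _ → tt) (λ {w} _ → from w) (sumTo-const (n ^ d) (suc n′))
        λ { (inj₁ one) → 0 , z≤n , _ , _ , one , refl , refl ; (inj₁ two) → 0 , z≤n , _ , _ , two , refl , refl
          ; (inj₂ one) → 1 , s≤s z≤n , _ , _ , one , refl , refl ; (inj₂ two) → 1 , s≤s z≤n , _ , _ , two , refl , refl } }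
    where
    open Liftable L
    R : Vertex n d → Vertex n d → Set
    R p q = OneOf u v u′ v′ p q ⊎ OneOf x y x′ y′ p q
    On : (Vertex n d → Vertex n d → Set) → ℕ → Vertex n (suc d) → Vertex n (suc d) → Set
    On S k p q = ∃₂ λ s t → S s t × p ≡ fin k ∷ s × q ≡ fin k ∷ t
    Layer : ℕ → Vertex n (suc d) → Set
    Layer k w = toℕ (head w) ≡ k
    layer : ∀ {k} → k ≤ suc n′ → Cycle (KnightAdj a 1 n (suc d)) (Layer k) (n ^ d) (On R k)
    layer {k} le = weaken (mapCycle (fin k ∷_) cycle (λ {p} {q} _ _ → knight-∷ (fin k) {p} {q}))
      (λ { (_ , _ , refl) → toℕ-fin (s≤s le) }) (λ { {i ∷ w} refl → w , tt , cong (_∷ w) (sym (fin-toℕ i)) }) refl id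
    lower : ∀ {k p q r s} → On (OneOf x y x′ y′) k p q → (∀ {p q} → OneOf x y x′ y′ p q → ¬ Same p q r s) → ¬ Same p q (fin k ∷ r) (fin k ∷ s)
    lower {k} (_ , _ , o , refl , refl) f = same-∷ (fin k) (f o)
    layers : Cycle (KnightAdj a 1 n (suc d)) (λ w → ∃ λ k → k ≤ suc n′ × Layer k w) (sumTo (λ _ → n ^ d) (suc n′))
      (λ p q → ∃ λ k → k ≤ suc n′ × On (OneOf x y x′ y′) k p q)
    layers = chain (λ {p} {q} → knight-sym {x = p} {q}) {R = On R} {F = On (OneOf x y x′ y′)}
      {u = λ k → fin k ∷ u} {v = λ k → fin k ∷ v} {u′ = λ k → fin k ∷ u′} {v′ = λ k → fin k ∷ v′} (suc n′)
      (λ p q → trans (sym p) q) layer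
      (u , v , inj₁ one , refl , refl) (u′ , v′ , inj₁ two , refl , refl)
      (λ {k} → same-∷ (fin k) u≢u′)
      (λ {k} l → knight-up {k = k} {u} {u′} (s≤s l) uu) (λ {k} l → knight-up {k = k} {v} {v′} (s≤s l) vv)
      (λ { (_ , _ , o , e , e′) → _ , _ , inj₂ o , e , e′ })
      (λ {k} o → lower {k} o free) (λ {k} o → lower {suc k} o free′)
    from : ∀ w → ∃ λ k → k ≤ suc n′ × Layer k w
    from (i ∷ w) = toℕ i , s≤s⁻¹ (toℕ<n i) , refl

  raise* : Liftable 2 → ∀ k → Liftable (2 + k)
  raise* L zero    = L
  raise* L (suc k) = raise (raise* L k)

-- The planar tour and the bound on n

module _ (g : ℕ) where

  private
    h : ℕ
    h = suc g

  module _ (β : ℕ) (h<β : h < β) where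

    private
      n′ : ℕ
      n′ = (β + h) + (β + h)

    planar : ThreeLevels g β (<⇒≤ h<β) → (∀ ρ → 6 ≤ rows g β (<⇒≤ h<β) ρ) → Liftable (h + h) n′ 2
    planar T 6≤ = record
      { u = at (β + β) 0 ; v = at (suc (β + β)) (h + h) ; u′ = at n′ 0 ; v′ = at (suc n′) (h + h)
      ; x = at (μ′ (β + β)) 0 ; y = at (μ′ (suc (β + β))) (h + h) ; x′ = at (μ′ n′) 0 ; y′ = at (μ′ (suc n′)) (h + h)
      ; uu = shift (β + β) n′ 0 2β<n n′<n dist ; vv = shift (suc (β + β)) (suc n′) (h + h) 2β+1<n ≤-refl dist′
      ; xx = shift (μ′ (β + β)) (μ′ n′) 0 (μ-<n (β + β)) (μ-<n n′) (reflect (≤N 2β<n) (≤N n′<n) dist)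
      ; yy = shift (μ′ (suc (β + β))) (μ′ (suc n′)) (h + h) (μ-<n (suc (β + β))) (μ-<n (suc n′)) (reflect (≤N 2β+1<n) (≤N ≤-refl) dist′)
      ; u≢u′ = differ (β + β) n′ (suc n′) 2β<n n′<n (<⇒≢ 2β<n′)
      ; x≢x′ = differ (μ′ (β + β)) (μ′ n′) (μ′ (suc n′)) (μ-<n (β + β)) (μ-<n n′) (λ e → case trans (sym μx) (trans e μx′) of λ ())
      ; free = λ
          { one → differ (μ′ (β + β)) (β + β) (suc (β + β)) (μ-<n (β + β)) 2β<n (λ e → <⇒≢ x<u (trans (sym μx) e))
          ; two → differ (μ′ n′) (β + β) (suc (β + β)) (μ-<n n′) 2β<n (λ e → <⇒≢ (<-trans 1<x x<u) (trans (sym μx′) e)) }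
      ; free′ = λ
          { one → differ (μ′ (β + β)) n′ (suc n′) (μ-<n (β + β)) n′<n (λ e → <⇒≢ (<-trans x<u 2β<n′) (trans (sym μx) e))
          ; two → differ (μ′ n′) n′ (suc n′) (μ-<n n′) n′<n (λ e → <⇒≢ (<-trans (<-trans 1<x x<u) 2β<n′) (trans (sym μx′) e)) }
      ; cycle = weaken (mapCycle place C adj) (λ _ → tt) (λ {w} _ → cover w) (cong (n *_) (sym (*-identityʳ n)))
          λ { (inj₁ one) → _ , _ , (false , inj₁ (refl , refl)) , refl , refl
            ; (inj₁ two) → _ , _ , (false , inj₂ (refl , refl)) , refl , refl
            ; (inj₂ one) → _ , _ , (true , inj₁ (refl , refl)) , refl , refl
            ; (inj₂ two) → _ , _ , (true , inj₂ (refl , refl)) , refl , refl } }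
      where
      n : ℕ
      n = suc (suc n′)
      size : suc (β + h) + suc (β + h) ≡ n
      size = cong suc (+-suc (β + h) (β + h))
      μ′ : ℕ → ℕ
      μ′ = μ g β (<⇒≤ h<β) true
      at : ℕ → ℕ → Vertex n 2
      at x y = fin (h + h) n′ x ∷ fin (h + h) n′ y ∷ []
      place : Square → Vertex n 2
      place (x , y) = at x y
      C : Cycle (SquareAdj g) (λ { (x , y) → x < n × y < n }) (n * n) (Displaced g β (<⇒≤ h<β) T 6≤)
      C = weaken (board g β (<⇒≤ h<β) T 6≤) (λ { {x , y} (l , l′) → subst (x <_) size l , subst (y <_) size l′ })
        (λ { {x , y} (l , l′) → subst (x <_) (sym size) l , subst (y <_) (sym size) l′ }) (cong₂ _*_ size size) id
      dist : Dist (h + h) (β + β) n′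
      dist = inj₁ (double-h g β)
      dist′ : Dist (h + h) (suc (β + β)) (suc n′)
      dist′ = inj₁ (cong suc (double-h g β))
      μx : μ′ (β + β) ≡ suc (h + h)
      μx = mirror-β g β (<⇒≤ h<β)
      μx′ : μ′ n′ ≡ 1
      μx′ = mirror-top g β (<⇒≤ h<β)
      -- Here h < β keeps the mirrored pair, at 1 and 2h + 1, apart from the pair at 2β and 2β + 2h.
      x<u : suc (h + h) < β + β
      x<u = double-mono-< h<β
      1<x : 1 < suc (h + h)
      1<x = s≤s (s≤s z≤n)
      2β<n′ : β + β < n′
      2β<n′ = +-mono-< (m<m+n β (s≤s z≤n)) (m<m+n β (s≤s z≤n))
      n′<n : n′ < n
      n′<n = n≤1+n (suc n′)
      2β<n : β + β < n
      2β<n = <-trans 2β<n′ n′<n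
      2β+1<n : suc (β + β) < n
      2β+1<n = s≤s (<-trans 2β<n′ ≤-refl)
      ≤N : ∀ {x} → x < n → x ≤ (β + h) + suc (β + h)
      ≤N {x} l = subst (x ≤_) (sym (+-suc (β + h) (β + h))) (s≤s⁻¹ l)
      μ-<n : ∀ x → μ′ x < n
      μ-<n x = subst (μ′ x <_) size (s≤s (m∸n≤m _ x))
      fin-≡ : ∀ {x x′} → x < n → x′ < n → fin (h + h) n′ x ≡ fin (h + h) n′ x′ → x ≡ x′
      fin-≡ l l′ e = trans (sym (toℕ-fin (h + h) n′ l)) (trans (cong toℕ e) (toℕ-fin (h + h) n′ l′))
      fin-∣-∣ : ∀ {k x x′} → x < n → x′ < n → Dist k x x′ → ∣ toℕ (fin (h + h) n′ x) - toℕ (fin (h + h) n′ x′) ∣ ≡ k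
      fin-∣-∣ {k} l l′ d = subst₂ (λ x y → ∣ x - y ∣ ≡ k) (sym (toℕ-fin (h + h) n′ l)) (sym (toℕ-fin (h + h) n′ l′)) (dist-∣-∣ d)
      shift : ∀ x x′ y → x < n → x′ < n → Dist (h + h) x x′ → Shifted (h + h) n′ (at x y) (at x′ y)
      shift _ _ _ l l′ d = zero , fin-∣-∣ l l′ d , λ { zero ne → ⊥-elim (ne refl) ; (suc zero) _ → refl }
      differ : ∀ x x′ y {q} → x < n → x′ < n → x ≢ x′ → ¬ Same (at x 0) q (at x′ 0) (at y (h + h))
      differ _ _ _ l l′ ne = apart (λ e → ne (fin-≡ l l′ (cong head e)))
        (λ e → case fin-≡ (s≤s z≤n) (<-trans (<-trans ≤-refl x<u) 2β<n) (cong (head ∘ tail) e) of λ ())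
      adj : ∀ {p q} → proj₁ p < n × proj₂ p < n → proj₁ q < n × proj₂ q < n → SquareAdj g p q → KnightAdj (h + h) 1 n 2 (place p) (place q)
      adj (lx , ly) (lx′ , ly′) (flat d e)  = zero , suc zero , (λ ()) , fin-∣-∣ lx lx′ d , fin-∣-∣ ly ly′ e ,
        λ { zero ne _ → ⊥-elim (ne refl) ; (suc zero) _ ne → ⊥-elim (ne refl) }
      adj (lx , ly) (lx′ , ly′) (steep d e) = suc zero , zero , (λ ()) , fin-∣-∣ ly ly′ e , fin-∣-∣ lx lx′ d ,
        λ { zero _ ne → ⊥-elim (ne refl) ; (suc zero) ne _ → ⊥-elim (ne refl) }
      cover : ∀ w → ∃ λ p → (proj₁ p < n × proj₂ p < n) × w ≡ place p
      cover (i ∷ j ∷ []) = (toℕ i , toℕ j) , (toℕ<n i , toℕ<n j) ,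
        cong₂ (λ k l → k ∷ l ∷ []) (sym (fin-toℕ (h + h) n′ i)) (sym (fin-toℕ (h + h) n′ j))

  -- Writing m − 1 = v + K · 2h with v < 2h, we have m = (v + 1)(2h + 1) + (K − v − 1) · 2h.
  decompose : ∀ m → (h + h) * suc (h + h) < m →
    ∃₂ λ v u → m ≡ suc v * suc (h + h) + suc u * (h + h)
  decompose (suc m) l = v , K ∸ suc (suc v) , trans (cong suc eq) (trans (cong (λ k → suc (v + k * (h + h))) (sym K≡)) (arith v (K ∸ suc (suc v)) (h + h)))
    where
    v K : ℕ
    v = m % (h + h)
    K = m / (h + h)
    eq : m ≡ v + K * (h + h)
    eq = m≡m%n+[m/n]*n m (h + h)
    -- K ≥ 2h + 1 ≥ v + 2 leaves at least one group of 2h positions, as the `suc u` demands.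
    K≥ : suc (suc v) ≤ K
    K≥ = ≤-trans (s≤s (m%n<n m (h + h))) (subst (_≤ K) (m*n/n≡m (suc (h + h)) (h + h))
      (/-monoˡ-≤ (h + h) (subst (_≤ m) (*-comm (h + h) (suc (h + h))) (s≤s⁻¹ l))))
    K≡ : suc (suc v) + (K ∸ suc (suc v)) ≡ K
    K≡ = m+[n∸m]≡n K≥
    arith : ∀ v u k → suc (v + (suc (suc v) + u) * k) ≡ suc v * suc k + suc u * k
    arith = solve-∀

  tour : ∀ m d → h * (12 * h + 2) ≤ m → KnightTour (h + h) 1 (m + m) (2 + d)
  tour m d le with decompose m big
    where
    arith : ∀ h → h * (4 * h + 2) ≡ (h + h) * suc (h + h)
    arith = solve-∀
    big : (h + h) * suc (h + h) < m
    big = <-≤-trans (subst (_< h * (12 * h + 2)) (arith h) (*-monoʳ-< h (+-monoˡ-< 2 (*-monoˡ-< h {4} {12} (m≤m+n 5 7))))) le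
  ... | v , u , e = subst (λ k → KnightTour (h + h) 1 k (2 + d)) n≡
    (cycle⇒tour (Liftable.cycle (raise* (h + h) _ (planar β h<β (three g β (<⇒≤ h<β) (threeLevels g v u (trans (sym m≡) e))) 6≤) d)))
    where
    -- As h ≥ 1, 12h + 2 ≥ 14. This yields 4h < m, which gives h < β, and 6h ≤ m, which gives every
    -- class at least six levels.
    14h≤m : h * 14 ≤ m
    14h≤m = ≤-trans (*-monoʳ-≤ h (+-monoˡ-≤ 2 (*-monoʳ-≤ 12 {1} {h} (s≤s z≤n)))) le
    4h<m : (h + h) + (h + h) < m
    4h<m = <-≤-trans (subst (_< h * 14) (arith h) (*-monoʳ-< h {4} {14} (m≤m+n 5 9))) 14h≤m
      where
      arith : ∀ h → h * 4 ≡ (h + h) + (h + h)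
      arith = solve-∀
    β : ℕ
    β = m ∸ suc h
    m≡ : m ≡ suc (β + h)
    m≡ = trans (sym (m∸n+n≡m (≤-trans (s≤s (m≤m+n h (h + (h + h)))) (subst (_< m) (+-assoc h h (h + h)) 4h<m)))) (+-suc β h)
    n≡ : suc (suc ((β + h) + (β + h))) ≡ m + m
    n≡ = trans (cong suc (sym (+-suc (β + h) (β + h)))) (sym (cong₂ _+_ m≡ m≡))
    h<β : h < β
    h<β = +-cancelʳ-< (suc h) h β (≤-trans (s≤s (≤-trans (≤-reflexive (+-suc h h)) (≤-trans (s≤s (m≤m+n (h + h) (g + h))) (≤-reflexive (sym (+-suc (h + h) (g + h))))))) (≤-trans 4h<m (≤-reflexive (trans m≡ (sym (+-suc β h))))))
    6≤ : ∀ ρ → 6 ≤ rows g β (<⇒≤ h<β) ρ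
    6≤ ρ = ≤-trans (subst (_≤ suc (β + h) / h) (m*n/n≡m 6 h) (/-monoˡ-≤ h (subst (6 * h ≤_) m≡ 6h≤m))) (m≤m+n _ _)
      where
      6h≤m : 6 * h ≤ m
      6h≤m = ≤-trans (≤-reflexive (*-comm 6 h)) (≤-trans (*-monoʳ-≤ h (m≤m+n 6 8)) 14h≤m)

theorem3 : (a n d : ℕ) → 1 ≤ a → 2 ∣ a → 1 ≤ n → 2 ∣ n →
    n ≥ a * (6 * a + 2) → d ≥ 2 → KnightTour a 1 n d
theorem3 .(q * 2) .(m * 2) (suc (suc d)) 1≤a (divides q refl) 1≤n (divides m refl) le (s≤s (s≤s z≤n)) = go q 1≤a le
  where
  double : ∀ k → k + k ≡ k * 2
  double = solve-∀
  arith : ∀ h → h * 2 * (6 * (h * 2) + 2) ≡ h * (12 * h + 2) * 2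
  arith = solve-∀
  go : ∀ q → 1 ≤ q * 2 → m * 2 ≥ q * 2 * (6 * (q * 2) + 2) → KnightTour (q * 2) 1 (m * 2) (2 + d)
  go (suc g) _ le = subst₂ (λ a n → KnightTour a 1 n (2 + d)) (double (suc g)) (double m)
    (tour g m d (*-cancelʳ-≤ _ _ 2 (subst (_≤ m * 2) (arith (suc g)) le)))
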